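{- Let $n\geq 1$ and $f\in F(n)$. If $f$ has at least one fixed point, then there exists $h\in F(n)$ with $h\sim f$ such that $\mathcal{A}(h)$ has exactly $\mathrm{fp}(f)$ attractors. If $f$ has no fixed point, then there exists $h\in F(n)$ with $h\sim f$ such that $\mathcal{A}(h)$ has a unique attractor, and this attractor has size at most $4$.
   Context: $F(n)$ is the set of all functions $f:\{0,1\}^n\to\{0,1\}^n$, written $f=(f_1,\dots,f_n)$. $e_i$ is the configuration with a $1$ exactly in component $i$; addition is componentwise modulo $2$. The asynchronous graph $\mathcal{A}(f)$ is the digraph on $\{0,1\}^n$ with an arc from $x$ to $x+e_i$ whenever $f_i(x)\neq x_i$. An attractor of a digraph on $\{0,1\}^n$ is an inclusion-minimal non-empty set $X\subseteq\{0,1\}^n$ such that there is no arc from $X$ to its complement. $\mathcal{S}(f)$ has an arc $x\to f(x)$ for every $x$; $f\sim h$ means $\mathcal{S}(f)$ and $\mathcal{S}(h)$ are isomorphic. A fixed point of $f$ is $x$ with $f(x)=x$; $\mathrm{fp}(f)$ is the number of fixed points. -}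

module Defs where

open import Data.Nat using (ℕ; zero; suc; _≤_)
open import Data.Bool using (Bool; true; false; not)
open import Data.Fin using (Fin)
open import Data.Vec using (Vec; []; _∷_; lookup; updateAt)
open import Data.Vec.Properties using (≡-dec)
open import Data.Bool.Properties using () renaming (_≟_ to _≟B_)
open import Data.List using (List; []; _∷_; map; _++_)
open import Data.Product using (Σ; ∃; _×_; _,_)
open import Relation.Nullary using (¬_; does)
open import Relation.Binary.PropositionalEquality using (_≡_)
open import Function.Bundles using (_↔_; Inverse)

Conf : ℕ → Set
Conf n = Vec Bool n

F : ℕ → Set
F n = Conf n → Conf n

_≟C_ : ∀ {n} (x y : Conf n) → Relation.Nullary.Dec (x ≡ y)
_≟C_ = ≡-dec _≟B_

flip : ∀ {n} → Fin n → Conf n → Conf n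
flip i x = updateAt x i not

allConfs : (n : ℕ) → List (Conf n)
allConfs zero = [] ∷ []
allConfs (suc n) = map (false ∷_) (allConfs n) ++ map (true ∷_) (allConfs n)

count : ∀ {A : Set} → (A → Bool) → List A → ℕ
count p [] = 0
count p (a ∷ as) with p a
... | true = suc (count p as)
... | false = count p as

fp : ∀ {n} → F n → ℕ
fp {n} f = count (λ x → does (f x ≟C x)) (allConfs n)

AArc : ∀ {n} → F n → Conf n → Conf n → Set
AArc f x y = ∃ λ i → (¬ lookup (f x) i ≡ lookup x i) × (y ≡ flip i x)

Subset : ℕ → Set
Subset n = Conf n → Bool

_∈S_ : ∀ {n} → Conf n → Subset n → Set
x ∈S X = X x ≡ true

NonEmpty : ∀ {n} → Subset n → Set
NonEmpty X = ∃ λ x → x ∈S X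

Trap : ∀ {n} → F n → Subset n → Set
Trap f X = ∀ x y → x ∈S X → AArc f x y → y ∈S X

_⊆S_ : ∀ {n} → Subset n → Subset n → Set
X ⊆S Y = ∀ x → x ∈S X → x ∈S Y

_≐_ : ∀ {n} → Subset n → Subset n → Set
X ≐ Y = (X ⊆S Y) × (Y ⊆S X)

IsAttractor : ∀ {n} → F n → Subset n → Set
IsAttractor f X =
  NonEmpty X × Trap f X ×
  (∀ Y → NonEmpty Y → Trap f Y → Y ⊆S X → X ⊆S Y)

NumAttractors : ∀ {n} → F n → ℕ → Set
NumAttractors {n} f k =
  Σ (Fin k → Subset n) λ A →
    (∀ i → IsAttractor f (A i)) ×
    (∀ i j → A i ≐ A j → i ≡ j) ×
    (∀ X → IsAttractor f X → ∃ λ i → X ≐ A i)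

size : ∀ {n} → Subset n → ℕ
size {n} X = count X (allConfs n)

-- f ∼ h : S(f) and S(h) isomorphic
_∼_ : ∀ {n} → F n → F n → Set
_∼_ {n} f h = Σ (Conf n ↔ Conf n) λ π →
  ∀ x → Inverse.to π (f x) ≡ h (Inverse.to π x)

{-# OPTIONS --safe #-}
module Submission where

-- Read configurations as binary numbers and relabel f so that bit-flips lead downwards. A position x
-- with h(x) < x has a one that h(x) lacks, so A(h) has an arc from x to a smaller number, which is
-- even when x is; and an odd x with h(x) even has an arc to x - 1. Number the vertices of f so that f
-- decreases, except that a cycle fills an interval and its first vertex, the start, is mapped to its
-- last one, the end. Swapping suitable neighbours (a , a + 1) with a odd puts starts at odd positions
-- and ends at even ones. Then every position reaches 0 or a fixed point; the only obstruction is an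
-- end at N - 1, whose start can instead go up to an odd position of its own cycle and then to an even
-- one. If f has a fixed point, put it at 0. Otherwise the attractor is the set reached from 0, and a
-- few positions near 0 are permuted to make it small, depending on the cycles of f:
-- a two-cycle gives {0, 2}; two disjoint paths of three vertices on cycles give {0, 1, 2, 6} with
-- 1 ↦ 0 ↦ 3 and 6 ↦ 2 ↦ 4; a single cycle of length 3, 4 or 5 with a vertex b attached gives
-- {0, 1, 2} with 1 ↦ 0, b = 2 ↦ 0 and 0 ↦ 3.

open import Defs
open import Data.Nat using (ℕ; zero; suc; _+_; _∸_; _≤_; _<_; z≤n; s≤s; pred; ⌊_/2⌋)
open import Data.Nat.Properties
open import Data.Nat.Induction using (<-rec)
open import Data.Bool using (Bool; true; false; not)
open import Data.Fin using (Fin; zero; suc; toℕ; fromℕ<)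
open import Data.Fin.Properties using (pigeonhole; toℕ<n; fromℕ<-injective)
open import Data.Vec using ([]; _∷_) renaming (lookup to _‼_)
open import Data.List using (List; []; _∷_; map; filter; length; lookup)
open import Data.List.Properties using (length-map)
open import Data.List.Relation.Unary.All as All using ([]; _∷_)
open import Data.List.Relation.Unary.Any using (here; there; any?; index)
open import Data.List.Relation.Unary.Any.Properties using (lookup-index)
open import Data.List.Relation.Unary.AllPairs using ([]; _∷_)
open import Data.List.Relation.Unary.Unique.Propositional using (Unique)
open import Data.List.Relation.Unary.Unique.Propositional.Properties using (map⁺; ++⁺; filter⁺)
open import Data.List.Membership.Propositional using (_∈_)
open import Data.List.Membership.Propositional.Properties using (∈-map⁺; ∈-map⁻; ∈-++⁺ˡ; ∈-++⁺ʳ; ∈-filter⁺; ∈-filter⁻; ∈-lookup; ∈-length)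
open import Data.Product using (Σ; ∃; _×_; _,_; proj₁; proj₂)
open import Data.Sum using (_⊎_; inj₁; inj₂)
open import Data.Empty using (⊥; ⊥-elim)
open import Function.Bundles using (mk↔ₛ′)
open import Relation.Nullary using (¬_; Dec; yes; no; does)
open import Relation.Nullary.Decidable using (True; toWitness; from-yes; dec-true; map′; ¬?; _×-dec_; _⊎-dec_; decidable-stable)
open import Relation.Unary using (Decidable)
open import Relation.Binary.Definitions using (tri<; tri≈; tri>)
open import Relation.Binary.PropositionalEquality using (_≡_; _≢_; refl; sym; trans; cong; cong₂; subst)

-- Configurations as binary numbers

-- The leading bit in which x and h(x) differ decides which is larger. If h(x) < x, clearing it
-- lowers x, and for even x it is not the last bit, so the descent stays among even numbers. Even
-- positions are therefore safe once none of them goes up, and an odd one needs only a smaller or an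
-- even image. On each cycle only the start is mapped upwards, so starts and ends are all that has
-- to be moved. N - 1 is odd and has no right neighbour to swap with. This hurts only if the last
-- cycle has length two: the swap then leaves N - 3 and N - 1 mapped to each other, and as they
-- differ in one bit they form a trap without 0. Hence two-cycles are numbered first, or right after
-- the fixed point. Near 0, the value 0 ↦ 3 opens exactly the arcs to 1 and 2, and 1 ↦ 0 returns. It
-- remains to bring 2 back: either 2 ↦ 0, which needs a second vertex with the image of 1, or 2 ↦ 4,
-- which adds only 6, and 6 ↦ 2 closes the set. The second way is open on one cycle with at least
-- six vertices or on two cycles with at least three each; a single shorter cycle leaves the first.

odd : ℕ → Bool
odd zero = false
odd (suc n) = not (odd n)

double : ℕ → ℕ
double zero = zero
double (suc n) = suc (suc (double n))

join : Bool → ℕ → ℕ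
join false k = double k
join true k = suc (double k)

not-not : ∀ b → not (not b) ≡ b
not-not false = refl
not-not true = refl

odd-double : ∀ k → odd (double k) ≡ false
odd-double zero = refl
odd-double (suc k) = trans (not-not _) (odd-double k)

odd-join : ∀ b k → odd (join b k) ≡ b
odd-join false k = odd-double k
odd-join true k = cong not (odd-double k)

half-double : ∀ k → ⌊ double k /2⌋ ≡ k
half-double zero = refl
half-double (suc k) = cong suc (half-double k)

half-join : ∀ b k → ⌊ join b k /2⌋ ≡ k
half-join false k = half-double k
half-join true zero = refl
half-join true (suc k) = cong suc (half-join true k)

join-suc : ∀ b k → join b (suc k) ≡ suc (suc (join b k))
join-suc false k = refl
join-suc true k = refl

join-half : ∀ p → join (odd p) ⌊ p /2⌋ ≡ p
join-half zero = refl
join-half (suc zero) = refl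
join-half (suc (suc p)) rewrite not-not (odd p) | join-suc (odd p) ⌊ p /2⌋ = cong (λ q → suc (suc q)) (join-half p)

double-mono-≤ : ∀ {j k} → j ≤ k → double j ≤ double k
double-mono-≤ z≤n = z≤n
double-mono-≤ (s≤s p) = s≤s (s≤s (double-mono-≤ p))

join< : ∀ b c {j k} → j < k → join b j < join c k
join< b c {j} {k} j<k = ≤-trans (upper b) (≤-trans (double-mono-≤ j<k) (lower c))
  where
  upper : ∀ b → suc (join b j) ≤ double (suc j)
  upper false = n≤1+n _
  upper true = ≤-refl
  lower : ∀ c → double k ≤ join c k
  lower false = ≤-refl
  lower true = n≤1+n _

join<⁻ : ∀ b c {j k} → join b j < join c k → j ≤ k
join<⁻ b c {j} {k} lt with j ≤? k
... | yes p = p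
... | no p = ⊥-elim (<-asym lt (join< c b (≰⇒> p)))

join<-double : ∀ b {j k} → join b j < double k → j < k
join<-double b {j} {k} lt with j <? k
... | yes p = p
... | no p = ⊥-elim (<-irrefl refl (<-≤-trans lt (≤-trans (double-mono-≤ (≮⇒≥ p)) (lower b))))
  where
  lower : ∀ c → double j ≤ join c j
  lower false = ≤-refl
  lower true = n≤1+n _

pow : ℕ → ℕ
pow zero = 1
pow (suc n) = double (pow n)

top : ℕ → ℕ
top zero = 0
top (suc n) = suc (double (top n))

pow≡1+top : ∀ n → pow n ≡ suc (top n)
pow≡1+top zero = refl
pow≡1+top (suc n) = cong double (pow≡1+top n)

val : ∀ {n} → Conf n → ℕ
val [] = 0
val (b ∷ x) = join b (val x)

bits : ∀ n → ℕ → Conf n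
bits zero p = []
bits (suc n) p = odd p ∷ bits n ⌊ p /2⌋

bits-val : ∀ {n} (x : Conf n) → bits n (val x) ≡ x
bits-val [] = refl
bits-val {suc n} (b ∷ x) = cong₂ _∷_ (odd-join b (val x)) (trans (cong (bits n) (half-join b (val x))) (bits-val x))

val< : ∀ {n} (x : Conf n) → val x < pow n
val< [] = s≤s z≤n
val< (b ∷ x) = join< b false (val< x)

half< : ∀ n p → p < pow (suc n) → ⌊ p /2⌋ < pow n
half< n p lt = join<-double (odd p) (subst (_< pow (suc n)) (sym (join-half p)) lt)

val-bits : ∀ n p → p < pow n → val (bits n p) ≡ p
val-bits zero zero lt = refl
val-bits zero (suc p) (s≤s ())
val-bits (suc n) p lt = trans (cong (join (odd p)) (val-bits n ⌊ p /2⌋ (half< n p lt))) (join-half p)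

-- Flip n p q p' : for any network h with h(p) = q, A(h) has an arc from p to p'.
Flip : ∀ n → ℕ → ℕ → ℕ → Set
Flip n p q p' = ∃ λ i → (¬ bits n q ‼ i ≡ bits n p ‼ i) × (bits n p' ≡ flip i (bits n p))

Flip-there : ∀ {n p q p'} → odd p' ≡ odd p → Flip n ⌊ p /2⌋ ⌊ q /2⌋ ⌊ p' /2⌋ → Flip (suc n) p q p'
Flip-there eq (i , ne , e) = suc i , ne , cong₂ _∷_ eq e

Flip-here : ∀ {n p q p'} → odd q ≢ odd p → odd p' ≡ not (odd p) → ⌊ p' /2⌋ ≡ ⌊ p /2⌋ → Flip (suc n) p q p'
Flip-here {n} ne o h = zero , ne , cong₂ _∷_ o (cong (bits n) h)

true≢false : true ≢ false
true≢false ()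

odd≢even : ∀ {p} → odd p ≡ true → odd p ≡ false → ⊥
odd≢even o e = true≢false (trans (sym o) e)

-- The leading bit in which p and q differ is one in p; p' is p with this bit cleared. Halving both
-- numbers removes the last bit until the halves agree. For even p the cleared bit is not the last
-- one, so p' stays even.
flip-down : ∀ n {p q} → p < pow n → q < p → ∃ λ p' → p' < p × (odd p ≡ false → odd p' ≡ false) × Flip n p q p'
flip-down zero {zero} lt ()
flip-down zero {suc p} (s≤s ()) q<p
flip-down (suc n) {p} {q} lt q<p with ⌊ q /2⌋ <? ⌊ p /2⌋
... | yes hq<hp =
      let p'' , p''< , _ , fl = flip-down n (half< n p lt) hq<hp
          p' = join (odd p) p''
      in p' , subst (p' <_) (join-half p) (join< (odd p) (odd p) p''<)
         , (λ e → trans (odd-join (odd p) p'') e)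
         , Flip-there {n} {p} {q} {p'} (odd-join (odd p) p'') (subst (Flip n ⌊ p /2⌋ ⌊ q /2⌋) (sym (half-join (odd p) p'')) fl)
... | no hq≮hp = body (odd q) (odd p) refl refl
  where
  j≡ : ⌊ q /2⌋ ≡ ⌊ p /2⌋
  j≡ = ≤-antisym (join<⁻ (odd q) (odd p) (subst (λ z → z < join (odd p) ⌊ p /2⌋) (sym (join-half q)) (subst (q <_) (sym (join-half p)) q<p)))
                 (≮⇒≥ hq≮hp)
  same : odd q ≡ odd p → ⊥
  same e = <-irrefl (trans (sym (join-half q)) (trans (cong₂ join e j≡) (join-half p))) q<p
  Res = ∃ λ p' → p' < p × (odd p ≡ false → odd p' ≡ false) × Flip (suc n) p q p'
  body : ∀ b c → odd q ≡ b → odd p ≡ c → Res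
  body false false e₁ e₂ = ⊥-elim (same (trans e₁ (sym e₂)))
  body true true e₁ e₂ = ⊥-elim (same (trans e₁ (sym e₂)))
  body true false e₁ e₂ = ⊥-elim (<-asym q<p (subst (_< q) p≡ (subst (suc (double ⌊ p /2⌋) ≤_) q≡ ≤-refl)))
    where
    p≡ : double ⌊ p /2⌋ ≡ p
    p≡ = trans (cong (λ b → join b ⌊ p /2⌋) (sym e₂)) (join-half p)
    q≡ : suc (double ⌊ p /2⌋) ≡ q
    q≡ = trans (cong₂ join (sym e₁) (sym j≡)) (join-half q)
  body false true e₁ e₂ = double ⌊ p /2⌋ , ≤-reflexive p≡ , (λ e → ⊥-elim (odd≢even {p} e₂ e)) ,
      Flip-here {n} {p} {q} {double ⌊ p /2⌋} (λ e → same e) (trans (odd-double ⌊ p /2⌋) (sym (cong not e₂))) (half-double ⌊ p /2⌋)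
    where
    p≡ : suc (double ⌊ p /2⌋) ≡ p
    p≡ = trans (cong (λ b → join b ⌊ p /2⌋) (sym e₂)) (join-half p)

half-suc-even : ∀ p → odd p ≡ false → ⌊ suc p /2⌋ ≡ ⌊ p /2⌋
half-suc-even zero e = refl
half-suc-even (suc zero) ()
half-suc-even (suc (suc p)) e = cong suc (half-suc-even p (trans (sym (not-not (odd p))) e))

not-injective : ∀ {b c} → not b ≡ not c → b ≡ c
not-injective {false} {false} e = refl
not-injective {true} {true} e = refl

flip-odd : ∀ n {p q} → suc p < pow n → odd p ≡ false → odd q ≡ false → Flip n (suc p) q p
flip-odd zero (s≤s ()) _ _
flip-odd (suc n) {p} {q} lt e e' = Flip-here {n} {suc p} {q} {p} (λ eq → true≢false (trans (cong not (sym e)) (trans (sym eq) e'))) (sym (not-not (odd p))) (sym (half-suc-even p e))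

-- `top n` has all bits one, so every zero bit of p may be raised. The recursion raises the highest
-- one.
flip-up : ∀ n {p} → p < top n → ∃ λ p' → p < p' × p' < pow n × Flip n p (top n) p'
flip-up zero ()
flip-up (suc n) {p} lt with ⌊ p /2⌋ <? top n
... | yes hp< =
      let p'' , <p'' , p''< , fl = flip-up n hp<
          p' = join (odd p) p''
      in p' , subst (_< p') (join-half p) (join< (odd p) (odd p) <p'')
         , join< (odd p) false p''<
         , Flip-there {n} {p} {top (suc n)} {p'} (odd-join (odd p) p'')
             (subst (Flip n ⌊ p /2⌋ _) (sym (half-join (odd p) p'')) (subst (λ t → Flip n ⌊ p /2⌋ t p'') (sym (half-join true (top n))) fl))
... | no hp≮ = body (odd p) refl
  where
  body : ∀ b → odd p ≡ b → ∃ λ p' → p < p' × p' < pow (suc n) × Flip (suc n) p (top (suc n)) p'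
  body true e = ⊥-elim (<⇒≱ lt (subst (suc (double (top n)) ≤_) (trans (cong (λ b → join b ⌊ p /2⌋) (sym e)) (join-half p)) (s≤s (double-mono-≤ (≮⇒≥ hp≮)))))
  body false e = suc p , ≤-refl , subst (suc p <_) (sym (pow≡1+top (suc n))) (s≤s lt) ,
     Flip-here {n} {p} {top (suc n)} {suc p} (λ eq → true≢false (trans (sym (odd-join true (top n))) (trans eq e))) refl (half-suc-even p e)

-- With 4 + p still below 2 ^ n, the quarter of p is not all ones, so a zero bit of weight at least
-- 4 can be raised. This leaves the last bit alone and gains at least 4.
flip-up-4 : ∀ n {p} → odd p ≡ true → 4 + p < pow n → ∃ λ p' → odd p' ≡ true × 4 + p ≤ p' × p' < pow n × Flip n p (top n) p'
flip-up-4 zero o (s≤s ())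
flip-up-4 (suc zero) o (s≤s (s≤s ()))
flip-up-4 (suc (suc n)) {p} o lt =
  let p₁ = ⌊ p /2⌋
      p₂ = ⌊ p₁ /2⌋
      t = top n
      h<t : p₂ < t
      h<t = ≤-pred (subst (suc p₂ <_) (pow≡1+top n) (half< n (suc (suc p₁)) (half< (suc n) (4 + p) lt)))
      q₂ , p₂<q₂ , q₂< , fl = flip-up n h<t
      q₁ = join (odd p₁) q₂
      q = join (odd p) q₁
      fl₁ = Flip-there {n} {p₁} {top (suc n)} {q₁} (odd-join (odd p₁) q₂)
              (subst (Flip n p₂ _) (sym (half-join (odd p₁) q₂)) (subst (λ t → Flip n p₂ t q₂) (sym (half-join true t)) fl))
      fl₀ = Flip-there {suc n} {p} {top (suc (suc n))} {q} (odd-join (odd p) q₁)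
              (subst (Flip (suc n) p₁ _) (sym (half-join (odd p) q₁)) (subst (λ t → Flip (suc n) p₁ t q₁) (sym (half-join true (top (suc n)))) fl₁))
      le₁ : suc (suc p₁) ≤ q₁
      le₁ = ≤-trans (≤-reflexive (trans (cong (λ z → suc (suc z)) (sym (join-half p₁))) (sym (join-suc (odd p₁) p₂)))) (join-mono (odd p₁) p₂<q₂)
      le₀ : 4 + p ≤ q
      le₀ = ≤-trans (≤-reflexive (trans (cong (4 +_) (sym (join-half p)))
              (trans (cong (λ z → suc (suc z)) (sym (join-suc (odd p) p₁))) (sym (join-suc (odd p) (suc p₁)))))) (join-mono (odd p) le₁)
  in q , trans (odd-join (odd p) q₁) o , le₀ , join< (odd p) false (join< (odd p₁) false q₂<) , fl₀
  where
  join-mono : ∀ b {j k} → j ≤ k → join b j ≤ join b k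
  join-mono false le = double-mono-≤ le
  join-mono true le = s≤s (double-mono-≤ le)

-- Reaching the origin, and swapping neighbours at odd positions

-- The origin is a legal endpoint whether or not it is fixed, so that one notion serves both halves
-- of the theorem: each non-empty trap contains 0 or a fixed point.
data Reach (n : ℕ) (g : ℕ → ℕ) : ℕ → Set where
  origin : Reach n g 0
  fixed : ∀ {p} → g p ≡ p → Reach n g p
  step : ∀ {p p'} → Flip n p (g p) p' → p' < pow n → Reach n g p' → Reach n g p

module _ (n : ℕ) (g : ℕ → ℕ) where

  descend : ∀ {p} → p < pow n → g p < p → (∀ p' → p' < p → (odd p ≡ false → odd p' ≡ false) → Reach n g p') → Reach n g p
  descend {p} p<N lt rec =
    let p' , p'<p , par , fl = flip-down n p<N lt
    in step fl (<-trans p'<p p<N) (rec p' p'<p par)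

  -- Induction over even numbers alone is possible because `flip-down` never makes an even position
  -- odd. Positions below m are supplied by hand.
  reach-even : ∀ m → (∀ x → x < m → odd x ≡ false → Reach n g x) →
    (∀ x → m ≤ x → x < pow n → odd x ≡ false → g x ≤ x) →
    ∀ x → x < pow n → odd x ≡ false → Reach n g x
  reach-even m small large = <-rec (λ x → x < pow n → odd x ≡ false → Reach n g x) body
    where
    body : ∀ x → (∀ {y} → y < x → y < pow n → odd y ≡ false → Reach n g y) → x < pow n → odd x ≡ false → Reach n g x
    body x rec x<N e with x <? m
    ... | yes x<m = small x x<m e
    ... | no x≮m with m≤n⇒m<n∨m≡n (large x (≮⇒≥ x≮m) x<N e)
    ...   | inj₁ lt = descend x<N lt (λ p' p'<p par → rec p'<p (<-trans p'<p x<N) (par e))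
    ...   | inj₂ eq = fixed eq

  -- An odd position may go up as long as its image is even: the last bits differ, so it drops to
  -- its even predecessor, which is already settled.
  reach-all : ∀ m → (∀ x → x < pow n → odd x ≡ false → Reach n g x) →
    (∀ x → x < m → x < pow n → odd x ≡ true → Reach n g x) →
    (∀ x → m ≤ x → x < pow n → odd x ≡ true → g x ≤ x ⊎ odd (g x) ≡ false ⊎ Reach n g x) →
    ∀ x → x < pow n → Reach n g x
  reach-all m evens small large = <-rec (λ x → x < pow n → Reach n g x) body
    where
    body : ∀ x → (∀ {y} → y < x → y < pow n → Reach n g y) → x < pow n → Reach n g x
    body x rec x<N with odd x in o
    ... | false = evens x x<N o
    ... | true with x <? m
    ...   | yes x<m = small x x<m x<N o
    ...   | no x≮m with large x (≮⇒≥ x≮m) x<N o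
    ...     | inj₂ (inj₂ r) = r
    body (suc y) rec x<N | true | no x≮m | inj₂ (inj₁ e) =
      step (flip-odd n x<N (not-injective o) e) (<-trans ≤-refl x<N) (rec ≤-refl (<-trans ≤-refl x<N))
    body x rec x<N | true | no x≮m | inj₁ le with m≤n⇒m<n∨m≡n le
    ... | inj₁ lt = descend x<N lt (λ p' p'<p par → rec p'<p (<-trans p'<p x<N))
    ... | inj₂ eq = fixed eq

top-odd : ∀ n {x} → x < top n → odd (top n) ≡ true
top-odd zero ()
top-odd (suc n) _ = odd-join true (top n)

record Perm (N : ℕ) : Set where
  field
    to from : ℕ → ℕ
    to< : ∀ {p} → p < N → to p < N
    from< : ∀ {p} → p < N → from p < N
    to-from : ∀ {p} → p < N → to (from p) ≡ p
    from-to : ∀ {p} → p < N → from (to p) ≡ p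

conj : ∀ {N} → Perm N → (ℕ → ℕ) → ℕ → ℕ
conj ρ g x = Perm.to ρ (g (Perm.from ρ x))

-- Positions below m are arranged by hand. Elsewhere g is decreasing except at the starts of blocks,
-- and at most one block crosses m.
record Blocks (N m : ℕ) (g : ℕ → ℕ) : Set where
  field
    bound : ∀ {p} → p < N → g p < N
    inner-descends : ∀ p r → p < N → p < r → m ≤ r → r ≤ g p → g r < r
    crossing-unique : ∀ p q → p < m → q < m → p < N → q < N → m ≤ g p → m ≤ g q → p ≡ q
    inner-pred : ∀ p r → p < N → m < r → suc p < r → r ≤ g p → suc (g r) ≡ r

module Swap (n m : ℕ) (g : ℕ → ℕ) (m-odd : odd m ≡ true) (B : Blocks (pow n) m g) where
  open Blocks B
  N = pow n

  -- For odd a these are the two reasons to exchange a and a + 1: a start sits on the even side, or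
  -- an end sits on the odd side.
  Sw : ℕ → Set
  Sw a = m ≤ a × suc a < N × (suc a < g (suc a) ⊎ ∃ λ p → p < a × g p ≡ a)

  sw? : ∀ a → Dec (Sw a)
  sw? a = (m ≤? a) ×-dec ((suc a <? N) ×-dec ((suc a <? g (suc a)) ⊎-dec anyUpTo? (λ p → g p ≟ a) a))

  data View : ℕ → ℕ → Set where
    odd-keep : ∀ {x} → odd x ≡ true → ¬ Sw x → View x x
    odd-up : ∀ {x} → odd x ≡ true → Sw x → View x (suc x)
    even-keep : ∀ {x} → odd x ≡ false → (∀ y → x ≡ suc y → ¬ Sw y) → View x x
    even-down : ∀ {y} → odd y ≡ true → Sw y → View (suc y) y

  place : ∀ x → ∃ (View x)
  place x with odd x in o
  place x | true with sw? x
  ... | yes s = suc x , odd-up o s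
  ... | no ¬s = x , odd-keep o ¬s
  place zero | false = zero , even-keep o (λ _ ())
  place (suc y) | false with sw? y
  ... | yes s = y , even-down (not-injective o) s
  ... | no ¬s = suc y , even-keep o (λ { _ refl → ¬s })

  View-unique : ∀ {x y z} → View x y → View x z → y ≡ z
  View-unique (odd-keep _ _) (odd-keep _ _) = refl
  View-unique (odd-keep _ ¬s) (odd-up _ s) = ⊥-elim (¬s s)
  View-unique {x} (odd-keep o _) (even-keep e _) = ⊥-elim (odd≢even {x} o e)
  View-unique {suc y} (odd-keep o _) (even-down o' _) = ⊥-elim (odd≢even {suc y} o (cong not o'))
  View-unique (odd-up _ s) (odd-keep _ ¬s) = ⊥-elim (¬s s)
  View-unique (odd-up _ _) (odd-up _ _) = refl
  View-unique {x} (odd-up o _) (even-keep e _) = ⊥-elim (odd≢even {x} o e)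
  View-unique {suc y} (odd-up o _) (even-down o' _) = ⊥-elim (odd≢even {suc y} o (cong not o'))
  View-unique {x} (even-keep e _) (odd-keep o _) = ⊥-elim (odd≢even {x} o e)
  View-unique {x} (even-keep e _) (odd-up o _) = ⊥-elim (odd≢even {x} o e)
  View-unique (even-keep _ _) (even-keep _ _) = refl
  View-unique (even-keep _ ¬s) (even-down _ s) = ⊥-elim (¬s _ refl s)
  View-unique {suc y} (even-down o' _) (odd-keep o _) = ⊥-elim (odd≢even {suc y} o (cong not o'))
  View-unique {suc y} (even-down o' _) (odd-up o _) = ⊥-elim (odd≢even {suc y} o (cong not o'))
  View-unique (even-down _ s) (even-keep _ ¬s) = ⊥-elim (¬s _ refl s)
  View-unique (even-down _ _) (even-down _ _) = refl

  View-sym : ∀ {x y} → View x y → View y x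
  View-sym v@(odd-keep _ _) = v
  View-sym (odd-up o s) = even-down o s
  View-sym v@(even-keep _ _) = v
  View-sym (even-down o s) = odd-up o s

  σ : ℕ → ℕ
  σ x = proj₁ (place x)

  σ-view : ∀ x → View x (σ x)
  σ-view x = proj₂ (place x)

  View⇒≡ : ∀ {x y} → View x y → σ x ≡ y
  View⇒≡ v = View-unique (σ-view _) v

  σσ : ∀ x → σ (σ x) ≡ x
  σσ x = View⇒≡ (View-sym (σ-view x))

  View< : ∀ {x y} → View x y → x < N → y < N
  View< (odd-keep _ _) lt = lt
  View< (odd-up _ (_ , s , _)) _ = s
  View< (even-keep _ _) lt = lt
  View< (even-down _ _) lt = <-trans ≤-refl lt

  σ-perm : Perm N
  σ-perm = record
    { to = σ ; from = σ ; to< = λ {p} → View< (σ-view p) ; from< = λ {p} → View< (σ-view p)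
    ; to-from = λ {p} _ → σσ p ; from-to = λ {p} _ → σσ p }

  g' : ℕ → ℕ
  g' = conj σ-perm g

  σ-small : ∀ {x} → x < m → σ x ≡ x
  σ-small {x} x<m with σ x | σ-view x
  ... | _ | odd-keep _ _ = refl
  ... | _ | odd-up _ (m≤x , _) = ⊥-elim (<⇒≱ x<m m≤x)
  ... | _ | even-keep _ _ = refl
  ... | _ | even-down _ (m≤y , _) = ⊥-elim (<⇒≱ x<m (≤-trans m≤y (n≤1+n _)))

  g'-small : ∀ {x} → x < m → g' x ≡ σ (g x)
  g'-small x<m = cong (λ z → σ (g z)) (σ-small x<m)

  View≤suc : ∀ {x y} → View x y → y ≤ suc x
  View≤suc (odd-keep _ _) = n≤1+n _
  View≤suc (odd-up _ _) = ≤-refl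
  View≤suc (even-keep _ _) = n≤1+n _
  View≤suc (even-down _ _) = ≤-trans (n≤1+n _) (n≤1+n _)

  σ≤ : ∀ {x z} → x < z → σ x ≤ z
  σ≤ {x} x<z = ≤-trans (View≤suc (σ-view x)) x<z

  -- If y were a start, y + 1 would lie inside its block and could not be a start as well, and y
  -- itself could not end an earlier block, where values decrease. So neither reason for `Sw y`
  -- would remain.
  start-not-swapped : ∀ {y} → y < N → Sw y → g y ≤ y
  start-not-swapped {y} y<N (m≤y , _ , why) = ≮⇒≥ (λ st → helper st why)
    where
    helper : y < g y → suc y < g (suc y) ⊎ (∃ λ p → p < y × g p ≡ y) → ⊥
    helper st (inj₁ st') = <-asym st' (inner-descends y (suc y) y<N ≤-refl (≤-trans m≤y (n≤1+n _)) st)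
    helper st (inj₂ (p , p<y , e)) = <-asym st (inner-descends p y (<-trans p<y y<N) p<y m≤y (≤-reflexive (sym e)))

  -- As m is odd, no pair (a , a + 1) with a odd straddles m.
  m<even : ∀ {x} → m ≤ suc x → odd (suc x) ≡ false → m ≤ x
  m<even {x} le e with m≤n⇒m<n∨m≡n le
  ... | inj₁ lt = ≤-pred lt
  ... | inj₂ refl = ⊥-elim (odd≢even {suc x} m-odd e)

  m≢0 : m ≢ 0
  m≢0 e = true≢false (trans (sym m-odd) (cong odd e))

  -- After the swaps no start sits at an even position from m on. A strictly smaller image is raised
  -- by `σ` by at most one, which still does not exceed x.
  even-descends : ∀ x → m ≤ x → x < N → odd x ≡ false → g' x ≤ x
  even-descends x m≤x x<N e with σ x | σ-view x
  ... | _ | odd-keep o _ = ⊥-elim (odd≢even {x} o e)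
  ... | _ | odd-up o _ = ⊥-elim (odd≢even {x} o e)
  even-descends zero m≤x x<N e | _ | even-keep _ _ = ⊥-elim (m≢0 (n≤0⇒n≡0 m≤x))
  even-descends x@(suc z) m≤x x<N e | _ | v@(even-keep _ ¬s) = case
    where
    case : σ (g x) ≤ x
    case with x <? g x
    ... | yes st = ⊥-elim (¬s z refl (m<even m≤x e , x<N , inj₁ st))
    ... | no ns with m≤n⇒m<n∨m≡n (≮⇒≥ ns)
    ...   | inj₂ eq rewrite eq = ≤-reflexive (View⇒≡ v)
    ...   | inj₁ lt = σ≤ lt
  even-descends (suc y) m≤x x<N e | _ | even-down o s = case (m≤n⇒m<n∨m≡n (start-not-swapped (<-trans ≤-refl x<N) s))
    where
    case : g y < y ⊎ g y ≡ y → σ (g y) ≤ suc y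
    case (inj₁ lt) = ≤-trans (σ≤ lt) (n≤1+n _)
    case (inj₂ eq) rewrite eq = ≤-reflexive (View⇒≡ (odd-up o s))

  -- Of p and y, the later one lies inside the block of the earlier one and would have to descend,
  -- although both go up. If the later one is below m, both blocks cross m and coincide by
  -- `crossing-unique`.
  no-end-inside : ∀ {y a p} → y < N → y ≤ a → a < g y → m ≤ a → p < a → g p ≡ a → ⊥
  no-end-inside {y} {a} {p} y<N y≤a a<gy m≤a p<a gp≡a with <-cmp p y
  ... | tri≈ _ refl _ = <-irrefl (sym gp≡a) a<gy
  ... | tri< p<y _ _ with m ≤? y
  ...   | yes m≤y = <-asym (≤-<-trans y≤a a<gy) (inner-descends p y (<-trans p<y y<N) p<y m≤y (subst (y ≤_) (sym gp≡a) y≤a))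
  ...   | no m≰y = <-irrefl (crossing-unique p y (<-trans p<y (≰⇒> m≰y)) (≰⇒> m≰y) (<-trans p<y y<N) y<N (subst (m ≤_) (sym gp≡a) m≤a) (≤-trans m≤a (<⇒≤ a<gy))) p<y
  no-end-inside {y} {a} {p} y<N y≤a a<gy m≤a p<a gp≡a | tri> _ _ y<p with m ≤? p
  ...   | yes m≤p = <-asym (subst (p <_) (sym gp≡a) p<a) (inner-descends y p y<N y<p m≤p (<⇒≤ (<-trans p<a a<gy)))
  ...   | no m≰p = <-irrefl (crossing-unique y p (<-trans y<p (≰⇒> m≰p)) (≰⇒> m≰p) y<N (<-trans p<a (<-trans a<gy (bound y<N))) (≤-trans m≤a (<⇒≤ a<gy)) (subst (m ≤_) (sym gp≡a) m≤a)) y<p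

  -- An odd end is exchanged with its right neighbour unless it has none, that is, unless it is N -
  -- 1. An even end e stays: e is not a start, and e - 1 is not an end because it lies in the same
  -- block.
  end-even : ∀ {y} → y < N → y < g y → m ≤ g y → odd (σ (g y)) ≡ false ⊎ (g y ≡ top n × σ (g y) ≡ top n)
  end-even {y} y<N st m≤e with g y in eq | σ (g y) | σ-view (g y)
  ... | e | w | v = go v
    where
    go : ∀ {w} → View e w → odd w ≡ false ⊎ (e ≡ top n × w ≡ top n)
    go (odd-keep o ¬s) = inj₂ (e≡ , e≡)
      where
      e≡ : e ≡ top n
      e≡ = ≤-antisym (≤-pred (subst (e <_) (pow≡1+top n) (subst (_< N) eq (bound y<N))))
                     (≤-pred (subst (_≤ suc e) (pow≡1+top n) (≮⇒≥ (λ lt → ¬s (m≤e , lt , inj₂ (y , st , eq))))))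
    go (odd-up o _) = inj₁ (cong not o)
    go (even-keep o _) = inj₁ o
    go (even-down {a} o (m≤a , _ , inj₁ st')) = ⊥-elim (<-asym st' (inner-descends y (suc a) y<N st m≤e (≤-reflexive (sym eq))))
    go (even-down {a} o (m≤a , _ , inj₂ (p , p<a , gp≡a))) = ⊥-elim (no-end-inside y<N (≤-pred st) (subst (a <_) (sym eq) ≤-refl) m≤a p<a gp≡a)

  -- Inside the block of a start y whose end is N - 1 nothing is swapped, so odd positions move to even ones.
  inside-last : ∀ {y s} → y < N → g y ≡ top n → odd (suc s) ≡ true → suc y ≤ s → m ≤ s → suc s ≤ top n → g' (suc s) ≡ s
  inside-last {y} {s} y<N gy o y<s m≤s s<t = trans (cong (λ z → σ (g z)) keep₁) (trans (cong σ (suc-injective (inner-pred y (suc s) y<N (s≤s m≤s) (s≤s y<s) (subst (suc s ≤_) (sym gy) s<t)))) keep₂)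
    where
    below : ∀ r → y < r → m ≤ r → r ≤ top n → ¬ (r < g r)
    below r y<r m≤r r≤t st = <-asym st (inner-descends y r y<N y<r m≤r (subst (r ≤_) (sym gy) r≤t))
    keep₁ : σ (suc s) ≡ suc s
    keep₁ = View⇒≡ (odd-keep o ns)
      where
      ns : ¬ Sw (suc s)
      ns (m≤ , lt , inj₁ st) = below _ (<-trans y<s (<-trans ≤-refl ≤-refl)) (≤-trans m≤ (n≤1+n _)) (≤-pred (subst (_ <_) (pow≡1+top n) lt)) st
      ns (m≤ , lt , inj₂ (p , p< , e)) = no-end-inside y<N (≤-trans (<⇒≤ y<s) (n≤1+n _)) (subst (suc s <_) (sym gy) (≤-pred (subst (_ <_) (pow≡1+top n) lt))) m≤ p< e
    keep₂ : σ s ≡ s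
    keep₂ = View⇒≡ (even-keep (not-injective o) ns)
      where
      ns : ∀ a → s ≡ suc a → ¬ Sw a
      ns a refl (m≤ , lt , inj₁ st) = below _ y<s m≤s (≤-trans (n≤1+n _) s<t) st
      ns a refl (m≤ , lt , inj₂ (p , p< , e)) = no-end-inside y<N (≤-pred y<s) (subst (a <_) (sym gy) (≤-trans (n≤1+n _) s<t)) m≤ p< e

  module _ (evens : ∀ x → x < N → odd x ≡ false → Reach n g' x) (long : g (pred (top n)) ≢ top n) where

    -- Here y is the vertex placed at x. If 4 + x < N, a jump of at least 4 lands on an odd s + 1
    -- with s beyond both m and y, and `inside-last` continues to the even s. Otherwise x is so
    -- close to the top that any raised bit works. The assumption `long` keeps y at least two below
    -- the end of its block.
    reach-from-last : ∀ {x y} → odd x ≡ true → x < N → y < N → y < g y → x ≤ y → y ≤ suc x → m ≤ suc (suc x) →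
      m ≤ suc x ⊎ 4 + x < N → g y ≡ top n → g' x ≡ top n → Reach n g' x
    reach-from-last {x} {y} o x<N y<N st x≤y y≤x+1 m≤x+2 room gy gx = start (4 + x <? N)
      where
      via : ∀ s → odd (suc s) ≡ true → suc y ≤ s → m ≤ s → suc s < N → Flip n x (top n) (suc s) → Reach n g' x
      via s os y<s m≤s s< fl =
        step (subst (λ z → Flip n x z (suc s)) (sym gx) fl) s<
          (step (subst (λ z → Flip n (suc s) z s) (sym (inside-last y<N gy os y<s m≤s (≤-pred (subst (suc s <_) (pow≡1+top n) s<))))
                  (flip-odd n s< (not-injective os) (not-injective os)))
                (<-trans ≤-refl s<) (evens s (<-trans ≤-refl s<) (not-injective os)))
      y<t : y < top n
      y<t = subst (y <_) gy st
      y+2≤t : suc (suc y) ≤ top n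
      y+2≤t with m≤n⇒m<n∨m≡n y<t
      ... | inj₁ lt = lt
      ... | inj₂ eq = ⊥-elim (long (trans (cong g (sym (cong pred eq))) gy))
      x<t : x < top n
      x<t = ≤-<-trans x≤y y<t
      start : Dec (4 + x < N) → Reach n g' x
      start (yes lt) with flip-up-4 n o lt
      ... | zero , () , _
      ... | suc s , os , le , s< , fl =
            via s os (≤-trans (s≤s y≤x+1) (≤-trans (n≤1+n _) (≤-pred le))) (≤-trans m≤x+2 (≤-trans (n≤1+n _) (≤-pred le))) s< fl
      start (no nlt) = last room (flip-up n x<t)
        where
        t≤x+3 : top n ≤ 3 + x
        t≤x+3 = ≤-pred (subst (_≤ 4 + x) (pow≡1+top n) (≮⇒≥ nlt))
        -- For y = x + 1 the two bounds force `top n` = x + 3, an even number since x is odd.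
        y≤x : y ≤ x
        y≤x with m≤n⇒m<n∨m≡n y≤x+1
        ... | inj₁ lt = ≤-pred lt
        ... | inj₂ refl = ⊥-elim (odd≢even {top n} (top-odd n x<t) (trans (cong odd (≤-antisym t≤x+3 y+2≤t)) (trans (not-not _) (cong not o))))
        last : m ≤ suc x ⊎ 4 + x < N → (∃ λ p' → x < p' × p' < pow n × Flip n x (top n) p') → Reach n g' x
        last (inj₂ lt) _ = ⊥-elim (nlt lt)
        last (inj₁ m≤x+1) (suc s , x<p , p< , fl) with odd (suc s) in os
        ... | false = step (subst (λ z → Flip n x z (suc s)) (sym gx) fl) p< (evens (suc s) p< os)
        ... | true = via s os (≤-trans (s≤s y≤x) x<s) (≤-trans m≤x+1 x<s) p< fl
          where
          x<s : x < s
          x<s with m≤n⇒m<n∨m≡n (≤-pred x<p)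
          ... | inj₁ lt = lt
          ... | inj₂ refl = ⊥-elim (odd≢even {x} o (not-injective os))

    odd-descends : ∀ x → m ≤ x → x < N → odd x ≡ true → g' x ≤ x ⊎ odd (g' x) ≡ false ⊎ Reach n g' x
    odd-descends x m≤x x<N o = go (σ-view x) refl
      where
      start : ∀ {y} → σ x ≡ y → y < N → x ≤ y → y ≤ suc x → y < g y → g' x ≤ x ⊎ odd (g' x) ≡ false ⊎ Reach n g' x
      start {y} eq y<N x≤y y≤ st with end-even y<N st (≤-trans m≤x (≤-trans x≤y (<⇒≤ st)))
      ... | inj₁ e = inj₂ (inj₁ (trans (cong (λ z → odd (σ (g z))) eq) e))
      ... | inj₂ (gy , σgy) = inj₂ (inj₂ (reach-from-last o x<N y<N st x≤y y≤ (≤-trans m≤x (≤-trans (n≤1+n _) (n≤1+n _))) (inj₁ (≤-trans m≤x (n≤1+n _))) gy (trans (cong (λ z → σ (g z)) eq) σgy)))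
      go : ∀ {y} → View x y → σ x ≡ y → g' x ≤ x ⊎ odd (g' x) ≡ false ⊎ Reach n g' x
      go v@(odd-keep _ _) eq with x <? g x
      ... | yes st = start eq x<N ≤-refl (n≤1+n _) st
      ... | no ns with m≤n⇒m<n∨m≡n (≮⇒≥ ns)
      ...   | inj₁ lt = inj₁ (subst (λ z → σ (g z) ≤ x) (sym eq) (σ≤ lt))
      ...   | inj₂ e = inj₁ (≤-reflexive (trans (cong (λ z → σ (g z)) eq) (trans (cong σ e) eq)))
      go v@(odd-up _ s) eq with suc x <? g (suc x)
      ... | yes st = start eq (View< v x<N) (n≤1+n _) ≤-refl st
      ... | no ns with m≤n⇒m<n∨m≡n (≮⇒≥ ns)
      ...   | inj₂ e = inj₁ (≤-reflexive (trans (cong (λ z → σ (g z)) eq) (trans (cong σ e) (View⇒≡ (View-sym v)))))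
      ...   | inj₁ lt with m≤n⇒m<n∨m≡n (≤-pred lt)
      ...     | inj₁ lt' = inj₁ (subst (λ z → σ (g z) ≤ x) (sym eq) (σ≤ lt'))
      ...     | inj₂ e = inj₂ (inj₁ (trans (cong (λ z → odd (σ (g z))) eq) (trans (cong (λ z → odd (σ z)) e) (trans (cong odd eq) (cong not o)))))
      go (even-keep e _) eq = ⊥-elim (odd≢even {x} o e)
      go (even-down o' _) eq = ⊥-elim (odd≢even {x} o (cong not o'))

-- Numberings of the vertices with contiguous cycles

-- `contiguous` has content only if p < g p; then p is the start of a cycle that fills the interval
-- from p to g p.
record Sorted (N : ℕ) (g : ℕ → ℕ) : Set where
  field
    bound : ∀ {p} → p < N → g p < N
    contiguous : ∀ p r → p < N → p < r → r ≤ g p → suc (g r) ≡ r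

record Labelled {n : ℕ} (f : F n) (g : ℕ → ℕ) : Set where
  field
    lab : Conf n → ℕ
    unl : ℕ → Conf n
    lab< : ∀ x → lab x < pow n
    lab-unl : ∀ {p} → p < pow n → lab (unl p) ≡ p
    unl-lab : ∀ x → unl (lab x) ≡ x
    commutes : ∀ x → lab (f x) ≡ g (lab x)

least : ∀ {P : ℕ → Set} → Decidable P → ∀ b → P b → ∃ λ k → P k × k ≤ b × (∀ i → i < k → ¬ P i)
least P? zero pb = zero , pb , z≤n , (λ _ ())
least {P} P? (suc b) pb with P? 0
... | yes p0 = 0 , p0 , z≤n , (λ _ ())
... | no ¬p0 =
      let k , pk , k≤b , min = least (λ i → P? (suc i)) b pb
      in suc k , pk , s≤s k≤b , λ { zero _ p → ¬p0 p ; (suc i) (s≤s lt) p → min i lt p }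

module Arrange {n : ℕ} (f : F n) where

  private
    V = Conf n
    N = pow n

  iter : ℕ → V → V
  iter zero x = x
  iter (suc k) x = f (iter k x)

  iter-+ : ∀ j k x → iter (j + k) x ≡ iter j (iter k x)
  iter-+ zero k x = refl
  iter-+ (suc j) k x = cong f (iter-+ j k x)

  any-conf? : ∀ {P : V → Set} → (∀ x → Dec (P x)) → Dec (∃ P)
  any-conf? {P} P? with anyUpTo? (λ p → P? (bits n p)) N
  ... | yes (p , _ , px) = yes (bits n p , px)
  ... | no ¬p = no λ { (x , px) → ¬p (val x , val< x , subst P (sym (bits-val x)) px) }

  collision : ∀ k → N < k → (at : ℕ → V) → ∃ λ i → ∃ λ j → i < j × j < k × at i ≡ at j
  collision k N<k at =
    let i , j , i<j , e = pigeonhole N<k (λ i → fromℕ< (val< (at (toℕ i))))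
    in toℕ i , toℕ j , i<j , toℕ<n j ,
       trans (sym (bits-val _)) (trans (cong (bits n) (fromℕ<-injective _ _ (val< (at (toℕ i))) (val< (at (toℕ j))) e)) (bits-val _))

  -- A partial numbering of a set closed under f. The last clause of `next` is `Sorted.contiguous`
  -- for the vertices placed so far.
  record State (k : ℕ) : Set where
    field
      at : ℕ → V
      inj : ∀ {p q} → p < k → q < k → at p ≡ at q → p ≡ q
      next : ∀ {p} → p < k → ∃ λ q → q < k × f (at p) ≡ at q × (∀ r → p < r → r ≤ q → f (at r) ≡ at (pred r))

  open State

  Placed : ∀ {k} → State k → V → Set
  Placed {k} s x = ∃ λ p → p < k × at s p ≡ x

  placed? : ∀ {k} (s : State k) x → Dec (Placed s x)
  placed? {k} s x = anyUpTo? (λ p → at s p ≟C x) k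

  _⊑_ : ∀ {k k'} → State k → State k' → Set
  _⊑_ {k} {k'} s s' = k ≤ k' × (∀ {p} → p < k → at s' p ≡ at s p)

  ⊑-refl : ∀ {k} {s : State k} → s ⊑ s
  ⊑-refl = ≤-refl , (λ _ → refl)

  ⊑-trans : ∀ {k k' k''} {s : State k} {s' : State k'} {s'' : State k''} → s ⊑ s' → s' ⊑ s'' → s ⊑ s''
  ⊑-trans (le , e) (le' , e') = ≤-trans le le' , (λ p → trans (e' (<-≤-trans p le)) (e p))

  placed-iter : ∀ {k} (s : State k) {x} j → Placed s x → Placed s (iter j x)
  placed-iter s zero pl = pl
  placed-iter s (suc j) pl with placed-iter s j pl
  ... | p , p< , e = let q , q< , fe , _ = next s p< in q , q< , trans (sym fe) (cong f e)

  state≤ : ∀ {k} → State k → k ≤ N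
  state≤ {k} s with k ≤? N
  ... | yes p = p
  ... | no ¬p = let i , j , i<j , j<k , e = collision k (≰⇒> ¬p) (at s)
                in ⊥-elim (<-irrefl (inj s (<-trans i<j j<k) j<k e) i<j)

  empty : State 0
  empty = record { at = λ _ → bits n 0 ; inj = λ () ; next = λ () }

  module _ {k : ℕ} (s : State k) (b : ℕ → V) (L : ℕ)
    (b-inj : ∀ {i j} → i < L → j < L → b i ≡ b j → i ≡ j)
    (b-new : ∀ {i} → i < L → ¬ Placed s (b i))
    (b-next : ∀ {i} → i < L → Placed s (f (b i)) ⊎
      (∃ λ j → j < L × f (b i) ≡ b j × (∀ r → i < r → r ≤ j → f (b r) ≡ b (pred r)))) where

    private
      at' : ℕ → V
      at' p with p <? k
      ... | yes _ = at s p
      ... | no _ = b (p ∸ k)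

    append-old : ∀ {p} → p < k → at' p ≡ at s p
    append-old {p} p<k with p <? k
    ... | yes _ = refl
    ... | no ¬p = ⊥-elim (¬p p<k)

    append-new : ∀ i → at' (k + i) ≡ b i
    append-new i with k + i <? k
    ... | yes p = ⊥-elim (<⇒≱ p (m≤m+n k i))
    ... | no _ = cong b (m+n∸m≡n k i)

    private
      data Split (p : ℕ) : Set where
        old : p < k → Split p
        new : ∀ i → i < L → p ≡ k + i → Split p

      split : ∀ {p} → p < k + L → Split p
      split {p} lt with p <? k
      ... | yes p<k = old p<k
      ... | no p≮k = new (p ∸ k) (+-cancelˡ-< k (p ∸ k) L (subst (_< k + L) (sym (m+[n∸m]≡n (≮⇒≥ p≮k))) lt)) (sym (m+[n∸m]≡n (≮⇒≥ p≮k)))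

    append : State (k + L)
    append = record { at = at' ; inj = inj' ; next = next' }
      where
      inj' : ∀ {p q} → p < k + L → q < k + L → at' p ≡ at' q → p ≡ q
      inj' p< q< e with split p< | split q<
      ... | old p<k | old q<k = inj s p<k q<k (trans (sym (append-old p<k)) (trans e (append-old q<k)))
      ... | old p<k | new j j< refl = ⊥-elim (b-new j< (_ , p<k , trans (sym (append-old p<k)) (trans e (append-new j))))
      ... | new i i< refl | old q<k = ⊥-elim (b-new i< (_ , q<k , trans (sym (append-old q<k)) (trans (sym e) (append-new i))))
      ... | new i i< refl | new j j< refl = cong (k +_) (b-inj i< j< (trans (sym (append-new i)) (trans e (append-new j))))

      next' : ∀ {p} → p < k + L → ∃ λ q → q < k + L × f (at' p) ≡ at' q × (∀ r → p < r → r ≤ q → f (at' r) ≡ at' (pred r))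
      next' {p} p< with split p<
      ... | old p<k =
            let q , q< , e , c = next s p<k
            in q , <-≤-trans q< (m≤m+n k L) , trans (cong f (append-old p<k)) (trans e (sym (append-old q<))) ,
               λ r p<r r≤q → trans (cong f (append-old (≤-<-trans r≤q q<)))
                               (trans (c r p<r r≤q) (sym (append-old (≤-<-trans pred[n]≤n (≤-<-trans r≤q q<)))))
      ... | new i i< refl with b-next i<
      ...   | inj₁ (q , q< , e) = q , <-≤-trans q< (m≤m+n k L) , trans (cong f (append-new i)) (trans (sym e) (sym (append-old q<))) ,
                -- A new vertex with an old image starts no block: the interval from p to q is
                -- empty.
                λ r p<r r≤q → ⊥-elim (<⇒≱ q< (≤-trans (m≤m+n k i) (≤-trans (<⇒≤ p<r) r≤q)))
      ...   | inj₂ (j , j< , e , c) = k + j , +-monoʳ-< k j< , trans (cong f (append-new i)) (trans e (sym (append-new j))) , inner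
        where
        inner : ∀ r → k + i < r → r ≤ k + j → f (at' r) ≡ at' (pred r)
        inner r lt le with r ∸ k in eq
        ... | zero = ⊥-elim (<⇒≱ lt (≤-trans (m∸n≡0⇒m≤n eq) (m≤m+n k i)))
        ... | suc d with r≡
          where
          r≡ : k + suc d ≡ r
          r≡ = trans (cong (k +_) (sym eq)) (m+[n∸m]≡n (≤-trans (m≤m+n k i) (<⇒≤ lt)))
        ...   | refl = trans (cong f (append-new (suc d)))
                         (trans (c (suc d) (+-cancelˡ-< k i (suc d) lt) (+-cancelˡ-≤ k (suc d) j le))
                           (trans (sym (append-new d)) (cong at' (sym (cong pred (+-suc k d))))))

    append-⊑ : s ⊑ append
    append-⊑ = m≤m+n k L , append-old

  record Period (x : V) (L : ℕ) : Set where
    field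
      positive : 0 < L
      returns : iter L x ≡ x
      minimal : ∀ i → 0 < i → i < L → iter i x ≢ x

  open Period

  period : ∀ x L → 0 < L → iter L x ≡ x → ∃ λ M → Period x M × M ≤ L
  period x (suc L) _ e with least (λ i → iter (suc i) x ≟C x) L e
  ... | M , e' , M≤ , min = suc M , record { positive = s≤s z≤n ; returns = e' ; minimal = λ { (suc i) _ (s≤s lt) → min i lt } } , s≤s M≤

  -- Applying f another L - j times turns a coincidence into a return to x after L - j + i < L
  -- steps.
  iter-distinct : ∀ {x L i j} → Period x L → i < j → j < L → iter i x ≢ iter j x
  iter-distinct {x} {L} {i} {j} P i<j j<L e =
    minimal P (L ∸ j + i) (<-≤-trans (m<n⇒0<n∸m j<L) (m≤m+n _ i))
      (<-≤-trans (+-monoʳ-< (L ∸ j) i<j) (≤-reflexive (m∸n+n≡m (<⇒≤ j<L))))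
      (trans (iter-+ (L ∸ j) i x) (trans (cong (iter (L ∸ j)) e) (trans (sym (iter-+ (L ∸ j) j x))
        (trans (cong (λ z → iter z x) (m∸n+n≡m (<⇒≤ j<L))) (returns P)))))

  iter-inj : ∀ {x L i j} → Period x L → i < L → j < L → iter i x ≡ iter j x → i ≡ j
  iter-inj {i = i} {j} P i<L j<L e with <-cmp i j
  ... | tri< i<j _ _ = ⊥-elim (iter-distinct P i<j j<L e)
  ... | tri≈ _ eq _ = eq
  ... | tri> _ _ j<i = ⊥-elim (iter-distinct P j<i i<L (sym e))

  module _ {k : ℕ} (s : State k) {x : V} {L : ℕ} (P : Period x (suc L)) (x-new : ¬ Placed s x) where

    private
      -- The cycle is numbered against the direction of f, so that f lowers numbers by one and sends
      -- the first to the last.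
      b : ℕ → V
      b j = iter (L ∸ j) x

      b-inj : ∀ {i j} → i < suc L → j < suc L → b i ≡ b j → i ≡ j
      b-inj {i} {j} (s≤s i≤) (s≤s j≤) e = ∸-cancelˡ-≡ i≤ j≤ (iter-inj P (s≤s (m∸n≤m L i)) (s≤s (m∸n≤m L j)) e)

      b-new : ∀ {i} → i < suc L → ¬ Placed s (b i)
      b-new {i} (s≤s i≤) pl = x-new (subst (Placed s) (trans (sym (iter-+ (suc i) (L ∸ i) x)) (trans (cong (λ z → iter (suc z) x) (m+[n∸m]≡n i≤)) (returns P))) (placed-iter s (suc i) pl))

      b-pred : ∀ r → 0 < r → r ≤ L → f (b r) ≡ b (pred r)
      b-pred (suc r) _ le = cong (λ z → iter z x) (sym (+-∸-assoc 1 le))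

      b-next : ∀ {i} → i < suc L → Placed s (f (b i)) ⊎
        (∃ λ j → j < suc L × f (b i) ≡ b j × (∀ r → i < r → r ≤ j → f (b r) ≡ b (pred r)))
      b-next {zero} _ = inj₂ (L , ≤-refl , trans (returns P) (cong (λ z → iter z x) (sym (n∸n≡0 L))) , λ r lt le → b-pred r lt le)
      b-next {suc i} (s≤s le) = inj₂ (i , <-trans le ≤-refl , b-pred (suc i) (s≤s z≤n) le , λ r lt le' → ⊥-elim (<⇒≱ lt (≤-trans le' (n≤1+n _))))

    add-cycle : State (k + suc L)
    add-cycle = append s b (suc L) b-inj b-new b-next

    add-cycle-⊑ : s ⊑ add-cycle
    add-cycle-⊑ = append-⊑ s b (suc L) b-inj b-new b-next

    add-cycle-at : ∀ i → at add-cycle (k + i) ≡ iter (L ∸ i) x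
    add-cycle-at = append-new s b (suc L) b-inj b-new b-next

    add-cycle-start : f (at add-cycle (k + 0)) ≡ at add-cycle (k + L)
    add-cycle-start = trans (cong f (add-cycle-at 0)) (trans (returns P) (sym (trans (add-cycle-at L) (cong (λ z → iter z x) (n∸n≡0 L)))))

  module _ {k : ℕ} (s : State k) (t : V) (t-new : ¬ Placed s t) (ft : Placed s (f t)) where

    private
      b-inj : ∀ {i j} → i < 1 → j < 1 → t ≡ t → i ≡ j
      b-inj (s≤s z≤n) (s≤s z≤n) _ = refl

    add-tree : State (k + 1)
    add-tree = append s (λ _ → t) 1 b-inj (λ _ → t-new) (λ _ → inj₁ ft)

    add-tree-⊑ : s ⊑ add-tree
    add-tree-⊑ = append-⊑ s (λ _ → t) 1 b-inj (λ _ → t-new) (λ _ → inj₁ ft)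

    add-tree-at : at add-tree (k + 0) ≡ t
    add-tree-at = append-new s (λ _ → t) 1 b-inj (λ _ → t-new) (λ _ → inj₁ ft) 0

  data Growth {k : ℕ} (s : State k) : Set where
    cycle : ∀ {x L} → Period x (suc L) → ¬ Placed s x → Growth s
    tree : ∀ t → ¬ Placed s t → Placed s (f t) → Growth s

  -- Follow f from x. If a placed vertex is met, the vertex just before the first one can be added
  -- as a tree vertex. Otherwise two of the first N + 1 iterates coincide and give a cycle; it is
  -- unplaced because all of these iterates are.
  grow : ∀ {k} (s : State k) x → ¬ Placed s x → Growth s
  grow s x new with anyUpTo? (λ i → placed? s (iter i x)) (suc N)
  ... | yes (i , _ , pl) with least (λ i → placed? s (iter i x)) i pl
  ...   | zero , pl' , _ , _ = ⊥-elim (new pl')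
  ...   | suc j , pl' , _ , min = tree (iter j x) (min j ≤-refl) pl'
  grow s x new | no none with collision (suc N) ≤-refl (λ i → iter i x)
  ... | i , j , i<j , j< , e with period (iter i x) (j ∸ i) (m<n⇒0<n∸m i<j)
                                    (trans (sym (iter-+ (j ∸ i) i x)) (trans (cong (λ z → iter z x) (m∸n+n≡m (<⇒≤ i<j))) (sym e)))
  ...   | suc L , P , _ = cycle P (λ pl → none (i , <-trans i<j j< , pl))
  ...   | zero , P , _ = ⊥-elim (n≮0 (positive P))

  Full : ∀ {k} → State k → Set
  Full s = ∀ x → Placed s x

  full? : ∀ {k} (s : State k) → Full s ⊎ ∃ λ x → ¬ Placed s x
  full? s with any-conf? (λ x → ¬? (placed? s x))
  ... | yes u = inj₂ u
  ... | no ¬u = inj₁ λ x → decidable-stable (placed? s x) (λ np → ¬u (x , np))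

  complete : ∀ d {k} (s : State k) → N ≤ k + d → ∃ λ k' → Σ (State k') λ s' → s ⊑ s' × Full s'
  complete d {k} s le with full? s
  ... | inj₁ full = k , s , ⊑-refl {s = s} , full
  ... | inj₂ (x , new) = more d le (grow s x new)
    where
    more : ∀ d → N ≤ k + d → Growth s → ∃ λ k' → Σ (State k') λ s' → s ⊑ s' × Full s'
    more zero le (cycle {L = L} P nw) = ⊥-elim (<⇒≱ (≤-trans (s≤s (≤-trans le (≤-reflexive (+-identityʳ k)))) (≤-trans (s≤s (m≤m+n k L)) (≤-reflexive (sym (+-suc k L))))) (state≤ (add-cycle s P nw)))
    more zero le (tree t nw ft) = ⊥-elim (<⇒≱ (≤-trans (s≤s (≤-trans le (≤-reflexive (+-identityʳ k)))) (≤-reflexive (+-comm 1 k))) (state≤ (add-tree s t nw ft)))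
    more (suc d) le (cycle {L = L} P nw) =
      let k' , s' , ext , full = complete d (add-cycle s P nw) (≤-trans le (≤-trans (≤-reflexive (+-suc k d)) (≤-trans (+-monoˡ-≤ d (s≤s (m≤m+n k L))) (≤-reflexive (cong (_+ d) (sym (+-suc k L)))))))
      in k' , s' , ⊑-trans {s = s} {add-cycle s P nw} {s'} (add-cycle-⊑ s P nw) ext , full
    more (suc d) le (tree t nw ft) =
      let k' , s' , ext , full = complete d (add-tree s t nw ft) (≤-trans le (≤-reflexive (sym (+-assoc k 1 d))))
      in k' , s' , ⊑-trans {s = s} {add-tree s t nw ft} {s'} (add-tree-⊑ s t nw ft) ext , full

  full⇒≡ : ∀ {k} (s : State k) → Full s → k ≡ N
  full⇒≡ {k} s full = ≤-antisym (state≤ s) (≮⇒≥ λ k<N →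
    let i , j , i<j , e = pigeonhole k<N (λ i → fromℕ< (proj₁ (proj₂ (full (bits n (toℕ i))))))
        lab≡ : proj₁ (full (bits n (toℕ i))) ≡ proj₁ (full (bits n (toℕ j)))
        lab≡ = fromℕ<-injective _ _ (proj₁ (proj₂ (full (bits n (toℕ i))))) (proj₁ (proj₂ (full (bits n (toℕ j))))) e
        b≡ : bits n (toℕ i) ≡ bits n (toℕ j)
        b≡ = trans (sym (proj₂ (proj₂ (full (bits n (toℕ i)))))) (trans (cong (at s) lab≡) (proj₂ (proj₂ (full (bits n (toℕ j))))))
    in <-irrefl (trans (sym (val-bits n _ (toℕ<n i))) (trans (cong val b≡) (val-bits n _ (toℕ<n j)))) i<j)

  record Sorting {k : ℕ} (s : State k) : Set where
    field
      g : ℕ → ℕ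
      sorted : Sorted N g
      labelled : Labelled f g
      agrees : ∀ {p q} → p < k → q < k → f (at s p) ≡ at s q → g p ≡ q
      unl≡ : ∀ {p} → p < k → Labelled.unl labelled p ≡ at s p

  abstract
    sort : ∀ {k} (s : State k) → Sorting s
    sort {k} s with complete N s (m≤n+m N k)
    ... | k' , s' , (k≤ , ext) , full with full⇒≡ s' full
    ...   | refl = record { g = g ; sorted = record { bound = λ p< → lab< _ ; contiguous = contig } ; labelled = labelled
                          ; agrees = λ {p} {q} p< q< e → lab-at (<-≤-trans q< k≤) (sym (trans (cong f (ext p<)) (trans e (sym (ext q<))))) ; unl≡ = ext }
      where
      lab : V → ℕ
      lab x = proj₁ (full x)
      lab< : ∀ x → lab x < N
      lab< x = proj₁ (proj₂ (full x))
      at-lab : ∀ x → at s' (lab x) ≡ x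
      at-lab x = proj₂ (proj₂ (full x))
      lab-at : ∀ {p x} → p < N → at s' p ≡ x → lab x ≡ p
      lab-at p< e = inj s' (lab< _) p< (trans (at-lab _) (sym e))
      g : ℕ → ℕ
      g p = lab (f (at s' p))
      labelled : Labelled f g
      labelled = record { lab = lab ; unl = at s' ; lab< = lab< ; lab-unl = λ p< → lab-at p< refl ; unl-lab = at-lab
                        ; commutes = λ x → cong (λ z → lab (f z)) (sym (at-lab x)) }
      contig : ∀ p r → p < N → p < r → r ≤ g p → suc (g r) ≡ r
      contig p (suc r) p< p<r r≤ with next s' p<
      ... | q , q< , e , c with lab-at q< (sym e)
      ...   | gp≡q = cong suc (lab-at (<-trans ≤-refl (≤-<-trans r≤ (lab< _))) (sym (c (suc r) p<r (subst (suc r ≤_) gp≡q r≤))))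

  two-period : ∀ {x} → f (f x) ≡ x → f x ≢ x → Period x 2
  two-period e ne = record { positive = s≤s z≤n ; returns = e ; minimal = λ { 1 _ _ e' → ne e' ; (suc (suc _)) _ (s≤s (s≤s ())) _ } }

  -- Placing every two-cycle early keeps them away from the last two positions, unless the pairs
  -- themselves extend that far; `exhausted` is what makes this argument work.
  record Paired {k : ℕ} (s : State k) : Set where
    field
      {k'} j : ℕ
      k'≡ : k' ≡ k + double j
      s' : State k'
      extends : s ⊑ s'
      link : ∀ p i → i < j → p ≡ k + double i → f (at s' p) ≡ at s' (suc p)
      exhausted : ∀ x → f (f x) ≡ x → f x ≢ x → Placed s' x

  abstract
    pair-up : ∀ d {k} (s : State k) → N ≤ k + d → Paired s
    pair-up d {k} s le with any-conf? (λ x → ((f (f x) ≟C x) ×-dec ¬? (f x ≟C x)) ×-dec ¬? (placed? s x))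
    ... | no none = record { j = 0 ; k'≡ = sym (+-identityʳ k) ; s' = s ; extends = ⊑-refl {s = s} ; link = λ _ _ ()
                           ; exhausted = λ x e ne → decidable-stable (placed? s x) (λ np → none (x , (e , ne) , np)) }
    ... | yes (x , (e , ne) , np) = more d le
      where
      P : Period x 2
      P = two-period e ne
      s₁ : State (k + 2)
      s₁ = add-cycle s P np
      more : ∀ d → N ≤ k + d → Paired s
      more zero le = ⊥-elim (<⇒≱ (≤-<-trans (≤-trans le (≤-reflexive (+-identityʳ k))) (≤-trans (n≤1+n _) (≤-reflexive (+-comm 2 k)))) (state≤ s₁))
      more (suc d) le = record
        { j = suc j ; k'≡ = trans k'≡ (+-assoc k 2 (double j)) ; s' = s' ; extends = ⊑-trans {s = s} {s₁} {s'} (add-cycle-⊑ s P np) extends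
        ; link = link' ; exhausted = exhausted }
        where
        open Paired (pair-up d s₁ (≤-trans le (≤-trans (+-monoʳ-≤ k (n≤1+n (suc d))) (≤-reflexive (sym (+-assoc k 2 d))))))
        link' : ∀ p i → i < suc j → p ≡ k + double i → f (at s' p) ≡ at s' (suc p)
        link' p zero _ refl = trans (cong f (proj₂ extends (+-monoʳ-< k (s≤s z≤n))))
          (trans (add-cycle-start s P np) (trans (sym (proj₂ extends (+-monoʳ-< k ≤-refl))) (cong (at s') (+-suc k 0))))
        link' p (suc i) (s≤s l) eq = link p i l (trans eq (sym (+-assoc k 2 (double i))))

-- From numbered networks to attractors

allConfs-complete : ∀ {n} (x : Conf n) → x ∈ allConfs n
allConfs-complete [] = here refl
allConfs-complete (false ∷ x) = ∈-++⁺ˡ (∈-map⁺ (false ∷_) (allConfs-complete x))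
allConfs-complete {suc n} (true ∷ x) = ∈-++⁺ʳ (map (false ∷_) (allConfs n)) (∈-map⁺ (true ∷_) (allConfs-complete x))

allConfs-unique : ∀ n → Unique (allConfs n)
allConfs-unique zero = [] ∷ []
allConfs-unique (suc n) = ++⁺ (map⁺ (λ { refl → refl }) (allConfs-unique n)) (map⁺ (λ { refl → refl }) (allConfs-unique n)) disjoint
  where
  disjoint : ∀ {x} → x ∈ map (false ∷_) (allConfs n) × x ∈ map (true ∷_) (allConfs n) → ⊥
  disjoint (p , q) with ∈-map⁻ (false ∷_) p | ∈-map⁻ (true ∷_) q
  ... | _ , _ , refl | _ , _ , ()

count≡length : ∀ {A : Set} {P : A → Set} (P? : Decidable P) xs → count (λ x → does (P? x)) xs ≡ length (filter P? xs)
count≡length P? [] = refl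
count≡length P? (x ∷ xs) with does (P? x)
... | true = cong suc (count≡length P? xs)
... | false = count≡length P? xs

lookup-injective : ∀ {A : Set} {xs : List A} → Unique xs → ∀ i j → lookup xs i ≡ lookup xs j → i ≡ j
lookup-injective (x ∷ u) zero zero e = refl
lookup-injective {xs = _ ∷ xs} (x ∷ u) zero (suc j) e = ⊥-elim (All.lookup x (∈-lookup {xs = xs} j) e)
lookup-injective {xs = _ ∷ xs} (x ∷ u) (suc i) zero e = ⊥-elim (All.lookup x (∈-lookup {xs = xs} i) (sym e))
lookup-injective (x ∷ u) (suc i) (suc j) e = cong suc (lookup-injective u i j e)

unique-length : ∀ {A : Set} {xs ys : List A} → Unique xs → (∀ {x} → x ∈ xs → x ∈ ys) → length xs ≤ length ys
unique-length {xs = xs} {ys} u sub = ≮⇒≥ λ lt →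
  let i , j , i<j , e = pigeonhole lt (λ i → index (sub (∈-lookup {xs = xs} i)))
  in <-irrefl (cong toℕ (lookup-injective u i j
       (trans (lookup-index (sub (∈-lookup {xs = xs} i))) (trans (cong (lookup ys) e) (sym (lookup-index (sub (∈-lookup {xs = xs} j)))))))) i<j

does⇒ : ∀ {P : Set} (P? : Dec P) → does P? ≡ true → P
does⇒ (yes p) _ = p
does⇒ (no _) ()

relabel : ∀ {n} {f : F n} {g} (ρ : Perm (pow n)) → Labelled f g → Labelled f (conj ρ g)
relabel {g = g} ρ ℓ = record
  { lab = λ x → to (lab x) ; unl = λ p → unl (from p) ; lab< = λ x → to< (lab< x)
  ; lab-unl = λ p< → trans (cong to (lab-unl (from< p<))) (to-from p<)
  ; unl-lab = λ x → trans (cong unl (from-to (lab< x))) (unl-lab x)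
  ; commutes = λ x → cong to (trans (commutes x) (cong g (sym (from-to (lab< x))))) }
  where
  open Perm ρ
  open Labelled ℓ

network : ∀ n → (ℕ → ℕ) → F n
network n g x = bits n (g (val x))

module _ {n : ℕ} {f : F n} {g : ℕ → ℕ} (ℓ : Labelled f g) where
  open Labelled ℓ

  labelled-bound : ∀ {p} → p < pow n → g p < pow n
  labelled-bound p< = subst (_< pow n) (trans (commutes (unl _)) (cong g (lab-unl p<))) (lab< _)

  network-∼ : network n g ∼ f
  network-∼ = mk↔ₛ′ (λ x → unl (val x)) (λ y → bits n (lab y))
                (λ y → trans (cong unl (val-bits n _ (lab< y))) (unl-lab y))
                (λ x → trans (cong (bits n) (lab-unl (val< x))) (bits-val x)) ,
    λ x → trans (cong unl (val-bits n _ (labelled-bound (val< x))))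
            (trans (cong (λ z → unl (g z)) (sym (lab-unl (val< x)))) (trans (cong unl (sym (commutes _))) (unl-lab _)))

network-bits : ∀ n g {p} → p < pow n → network n g (bits n p) ≡ bits n (g p)
network-bits n g p< = cong (λ z → bits n (g z)) (val-bits n _ p<)

module _ {n : ℕ} {g : ℕ → ℕ} where

  trap-flip : ∀ {Y} → Trap (network n g) Y → ∀ {p p'} → p < pow n → bits n p ∈S Y → Flip n p (g p) p' → bits n p' ∈S Y
  trap-flip trap p< mem (i , ne , e) = trap _ _ mem (i , (λ eq → ne (trans (cong (_‼ i) (sym (network-bits n g p<))) eq)) , e)

  trap-reach : ∀ {Y} → Trap (network n g) Y → ∀ {p} → p < pow n → bits n p ∈S Y → Reach n g p →
    bits n 0 ∈S Y ⊎ ∃ λ q → q < pow n × g q ≡ q × bits n q ∈S Y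
  trap-reach trap p< mem origin = inj₁ mem
  trap-reach trap p< mem (fixed e) = inj₂ (_ , p< , e , mem)
  trap-reach trap p< mem (step fl p'< r) = trap-reach trap p'< (trap-flip trap p< mem fl) r

module _ {n : ℕ} {g : ℕ → ℕ} (all-reach : ∀ p → p < pow n → Reach n g p) where

  private
    h = network n g

    conf-reach : ∀ {Y} → Trap h Y → NonEmpty Y → bits n 0 ∈S Y ⊎ ∃ λ q → q < pow n × g q ≡ q × bits n q ∈S Y
    conf-reach {Y} trap (x , mem) = trap-reach trap (val< x) (subst (_∈S Y) (sym (bits-val x)) mem) (all-reach (val x) (val< x))

  -- Since 0 is fixed, each non-empty trap contains a fixed point, and a single fixed point is
  -- already a trap. So the attractors are exactly these singletons.
  fixed-attractors : g 0 ≡ 0 → {f : F n} → Labelled f g → NumAttractors h (fp f)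
  fixed-attractors g0 {f} ℓ = subst (NumAttractors h) (sym (count≡length fix? (allConfs n))) (A , isAttr , distinct , complete')
    where
    open Labelled ℓ
    fix? : ∀ x → Dec (f x ≡ x)
    fix? x = f x ≟C x
    fs = filter fix? (allConfs n)
    point : Fin (length fs) → Conf n
    point i = bits n (lab (lookup fs i))
    A : Fin (length fs) → Subset n
    A i x = does (point i ≟C x)
    self : ∀ i → point i ∈S A i
    self i = dec-true (point i ≟C point i) refl
    h-point : ∀ i → h (point i) ≡ point i
    h-point i = trans (network-bits n g (lab< _)) (cong (bits n) (trans (sym (commutes _)) (cong lab (proj₂ (∈-filter⁻ fix? {xs = allConfs n} (∈-lookup {xs = fs} i))))))
    isAttr : ∀ i → IsAttractor h (A i)
    isAttr i = (point i , self i) , trap , least'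
      where
      trap : Trap h (A i)
      trap x y mem (j , ne , _) with does⇒ (point i ≟C x) mem
      ... | refl = ⊥-elim (ne (cong (_‼ j) (h-point i)))
      least' : ∀ Y → NonEmpty Y → Trap h Y → Y ⊆S A i → A i ⊆S Y
      least' Y (y , mem) _ sub x xin with does⇒ (point i ≟C y) (sub y mem) | does⇒ (point i ≟C x) xin
      ... | refl | refl = mem
    distinct : ∀ i j → A i ≐ A j → i ≡ j
    distinct i j (sub , _) = lookup-injective (filter⁺ fix? (allConfs-unique n)) i j
      (trans (sym (unl-lab _)) (trans (cong unl (sym (trans (sym (val-bits n _ (lab< _))) (trans (cong val (does⇒ (point j ≟C point i) (sub _ (self i)))) (val-bits n _ (lab< _)))))) (unl-lab _)))
    find-point : ∀ q → q < pow n → g q ≡ q → ∃ λ i → point i ≡ bits n q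
    find-point q q< e = index mem , cong (bits n) (trans (cong lab (sym (lookup-index mem))) (lab-unl q<))
      where
      mem : unl q ∈ fs
      mem = ∈-filter⁺ fix? (allConfs-complete (unl q)) (trans (sym (unl-lab _)) (cong unl (trans (commutes _) (trans (cong g (lab-unl q<)) e))))
    N>0 : 0 < pow n
    N>0 = subst (0 <_) (sym (pow≡1+top n)) (s≤s z≤n)
    complete' : ∀ X → IsAttractor h X → ∃ λ i → X ≐ A i
    complete' X (ne , trap , min) = found (conf-reach trap ne)
      where
      at-fixed : ∀ q → q < pow n → g q ≡ q → bits n q ∈S X → ∃ λ i → X ≐ A i
      at-fixed q q< e mem with find-point q q< e
      ... | i , eq = i , min (A i) (point i , self i) (proj₁ (proj₂ (isAttr i))) sub , sub
        where
        sub : A i ⊆S X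
        sub x xin = subst (_∈S X) (trans (sym eq) (does⇒ (point i ≟C x) xin)) mem
      found : bits n 0 ∈S X ⊎ (∃ λ q → q < pow n × g q ≡ q × bits n q ∈S X) → ∃ λ i → X ≐ A i
      found (inj₁ mem) = at-fixed 0 N>0 g0 mem
      found (inj₂ (q , q< , e , mem)) = at-fixed q q< e mem

data Path (n : ℕ) (g : ℕ → ℕ) (p : ℕ) : ℕ → Set where
  done : Path n g p p
  _then_ : ∀ {q r} → Path n g p q → (q < pow n × Flip n q (g q) r) → Path n g p r

trap-path : ∀ {n g Y} → Trap (network n g) Y → ∀ {p q} → bits n p ∈S Y → Path n g p q → bits n q ∈S Y
trap-path trap mem done = mem
trap-path trap mem (π then (q< , fl)) = trap-flip trap q< (trap-path trap mem π) fl

SmallAttractor : ∀ {n} → F n → Set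
SmallAttractor {n} h = Σ (Subset n) λ X → IsAttractor h X × (∀ Y → IsAttractor h Y → Y ≐ X) × size X ≤ 4

-- A certificate that R is the set reached from 0: `R-path` puts R into every trap containing 0, and
-- `R-closed` makes R a trap itself.
record OriginClosure (n : ℕ) (g : ℕ → ℕ) : Set where
  field
    R : List ℕ
    zero∈ : 0 ∈ R
    R≤4 : length R ≤ 4
    R< : ∀ {r} → r ∈ R → r < pow n
    R-path : ∀ {r} → r ∈ R → Path n g 0 r
    R-closed : ∀ {r} → r ∈ R → ∀ i → (¬ bits n (g r) ‼ i ≡ bits n r ‼ i) → ∃ λ r' → r' ∈ R × flip i (bits n r) ≡ bits n r'

module _ {n : ℕ} {g : ℕ → ℕ} (all-reach : ∀ p → p < pow n → Reach n g p) (no-fixed : ∀ p → p < pow n → g p ≢ p) (C : OriginClosure n g) where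
  open OriginClosure C

  private
    h = network n g
    X? : ∀ x → Dec (x ∈ map (bits n) R)
    X? x = any? (x ≟C_) (map (bits n) R)
    X : Subset n
    X x = does (X? x)

    in-X : ∀ {r} → r ∈ R → bits n r ∈S X
    in-X {r} mem = dec-true (X? (bits n r)) (∈-map⁺ (bits n) mem)

    trap : Trap h X
    trap x y mem (i , ne , refl) with ∈-map⁻ (bits n) (does⇒ (X? x) mem)
    ... | r , r∈ , refl with R-closed r∈ i (λ e → ne (trans (cong (_‼ i) (network-bits n g (R< r∈))) e))
    ...   | r' , r'∈ , e = subst (_∈S X) (sym e) (in-X r'∈)

    covers : ∀ Y → NonEmpty Y → Trap h Y → X ⊆S Y
    covers Y (y , ymem) tr x mem with ∈-map⁻ (bits n) (does⇒ (X? x) mem)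
    ... | r , r∈ , refl with trap-reach tr (val< y) (subst (_∈S Y) (sym (bits-val y)) ymem) (all-reach (val y) (val< y))
    ...   | inj₁ z = trap-path tr z (R-path r∈)
    ...   | inj₂ (q , q< , e , _) = ⊥-elim (no-fixed q q< e)

    nonempty : NonEmpty X
    nonempty = bits n 0 , in-X zero∈

  -- Without fixed points each non-empty trap contains 0 and hence all of R. So R is the least
  -- non-empty trap, which gives minimality and uniqueness at once.
  small-attractor : SmallAttractor h
  small-attractor = X , (nonempty , trap , λ Y ne tr _ → covers Y ne tr) ,
    (λ Y at → let ne , tr , min = at in min X nonempty trap (covers Y ne tr) , covers Y ne tr) ,
    ≤-trans (≤-reflexive (count≡length X? (allConfs n)))
      (≤-trans (unique-length (filter⁺ X? (allConfs-unique n)) (λ m → proj₂ (∈-filter⁻ X? {xs = allConfs n} m)))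
        (≤-trans (≤-reflexive (length-map (bits n) R)) R≤4))

-- Layouts of the first few positions

entry : ℕ → List ℕ → ℕ → ℕ
entry d [] _ = d
entry d (x ∷ xs) zero = x
entry d (x ∷ xs) (suc i) = entry d xs i

-- The default value is the argument itself, so a finite list describes a map that is the identity
-- beyond its length.
table : List ℕ → ℕ → ℕ
table xs p = entry p xs p

table-beyond : ∀ xs {p} → length xs ≤ p → table xs p ≡ p
table-beyond xs {p} = go xs p
  where
  go : ∀ ys i → length ys ≤ i → entry p ys i ≡ p
  go [] i le = refl
  go (y ∷ ys) (suc i) (s≤s le) = go ys i le

Inverse : ℕ → List ℕ → List ℕ → Set
Inverse m xs ys = ∀ p → p < m → table xs p < m × table ys p < m × table xs (table ys p) ≡ p × table ys (table xs p) ≡ p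

inverse? : ∀ m xs ys → Dec (Inverse m xs ys)
inverse? m xs ys = map′ (λ h p → h {p}) (λ h {p} → h p)
  (allUpTo? (λ p → (table xs p <? m) ×-dec ((table ys p <? m) ×-dec ((table xs (table ys p) ≟ p) ×-dec (table ys (table xs p) ≟ p)))) m)

module Twist (N m : ℕ) (xs ys : List ℕ) (xs-len : length xs ≡ m) (ys-len : length ys ≡ m) (inv : Inverse m xs ys) (m≤N : m ≤ N) where

  to from : ℕ → ℕ
  to = table xs
  from = table ys

  to-fix : ∀ {p} → m ≤ p → to p ≡ p
  to-fix le = table-beyond xs (subst (_≤ _) (sym xs-len) le)

  from-fix : ∀ {p} → m ≤ p → from p ≡ p
  from-fix le = table-beyond ys (subst (_≤ _) (sym ys-len) le)

  to-small : ∀ {p} → p < m → to p < m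
  to-small lt = proj₁ (inv _ lt)

  from-small : ∀ {p} → p < m → from p < m
  from-small lt = proj₁ (proj₂ (inv _ lt))

  τ : Perm N
  τ = record { to = to ; from = from ; to< = to< ; from< = from< ; to-from = λ {p} _ → tf p ; from-to = λ {p} _ → ft p }
    where
    to< : ∀ {p} → p < N → to p < N
    to< {p} lt with p <? m
    ... | yes l = <-≤-trans (to-small l) m≤N
    ... | no l = subst (_< N) (sym (to-fix (≮⇒≥ l))) lt
    from< : ∀ {p} → p < N → from p < N
    from< {p} lt with p <? m
    ... | yes l = <-≤-trans (from-small l) m≤N
    ... | no l = subst (_< N) (sym (from-fix (≮⇒≥ l))) lt
    tf : ∀ p → to (from p) ≡ p
    tf p with p <? m
    ... | yes l = proj₁ (proj₂ (proj₂ (inv _ l)))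
    ... | no l = trans (cong to (from-fix (≮⇒≥ l))) (to-fix (≮⇒≥ l))
    ft : ∀ p → from (to p) ≡ p
    ft p with p <? m
    ... | yes l = proj₂ (proj₂ (proj₂ (inv _ l)))
    ... | no l = trans (cong from (to-fix (≮⇒≥ l))) (from-fix (≮⇒≥ l))

  to-large : ∀ {p} → m ≤ to p → m ≤ p
  to-large {p} le with p <? m
  ... | yes l = ⊥-elim (<⇒≱ (to-small l) le)
  ... | no l = ≮⇒≥ l

  to-large≡ : ∀ {p} → m ≤ to p → to p ≡ p
  to-large≡ le = to-fix (to-large le)

  module _ (g : ℕ → ℕ) where

    twisted : ℕ → ℕ
    twisted = conj τ g

    twisted-large : ∀ {p} → m ≤ p → twisted p ≡ to (g p)
    twisted-large le = cong (λ z → to (g z)) (from-fix le)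

    to≤ : ∀ {p r} → m ≤ r → p < r → to p < r
    to≤ {p} m≤r p<r with p <? m
    ... | yes l = <-≤-trans (to-small l) m≤r
    ... | no l = subst (_< _) (sym (to-fix (≮⇒≥ l))) p<r

    module _ (S : Sorted N g) where
      open Sorted S

      private
        origin-of : ∀ {p r} → p < N → p < r → m ≤ r → r ≤ twisted p → from p < r × r ≤ g (from p)
        origin-of {p} {r} p<N p<r m≤r r≤ = from<r , subst (r ≤_) (to-large≡ (≤-trans m≤r r≤)) r≤
          where
          from<r : from p < r
          from<r with p <? m
          ... | yes l = <-≤-trans (from-small l) m≤r
          ... | no l = subst (_< r) (sym (from-fix (≮⇒≥ l))) p<r

        pred-of : ∀ {p r} → p < N → p < r → m ≤ r → r ≤ twisted p → suc (g r) ≡ r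
        pred-of {p} {r} p<N p<r m≤r r≤ = let a , b = origin-of p<N p<r m≤r r≤ in contiguous (from p) r (Perm.from< τ p<N) a b

      -- Nothing moves from m on, so the part of a block lying there is still traversed downwards.
      -- Of two starts below m, the later would lie inside the block of the earlier if both blocks
      -- crossed m, and would then descend.
      blocks : Blocks N m twisted
      blocks = record
        { bound = λ p< → Perm.to< τ (bound (Perm.from< τ p<))
        ; inner-descends = λ p r p<N p<r m≤r r≤ → subst (_< r) (sym (twisted-large m≤r)) (to≤ m≤r (≤-reflexive (pred-of p<N p<r m≤r r≤)))
        ; crossing-unique = unique
        ; inner-pred = λ p r p<N m<r p+1<r r≤ →
            let e = pred-of p<N (<-trans ≤-refl p+1<r) (<⇒≤ m<r) r≤
            in trans (cong suc (trans (twisted-large (<⇒≤ m<r)) (to-fix (≤-pred (subst (m <_) (sym e) m<r))))) e }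
        where
        clash : ∀ {p q} → p < m → q < m → m ≤ g p → m ≤ g q → p < q → ⊥
        clash {p} {q} p<m q<m mp mq p<q = <⇒≱ (<-trans (≤-reflexive (contiguous p q (<-≤-trans p<m m≤N) p<q (≤-trans (<⇒≤ q<m) mp))) q<m) mq
        unique : ∀ p q → p < m → q < m → p < N → q < N → m ≤ twisted p → m ≤ twisted q → p ≡ q
        unique p q p<m q<m p<N q<N mp mq with <-cmp (from p) (from q)
        ... | tri< lt _ _ = ⊥-elim (clash (from-small p<m) (from-small q<m) (to-large mp) (to-large mq) lt)
        ... | tri> _ _ gt = ⊥-elim (clash (from-small q<m) (from-small p<m) (to-large mq) (to-large mp) gt)
        ... | tri≈ _ e _ = trans (sym (Perm.to-from τ p<N)) (trans (cong to e) (Perm.to-from τ q<N))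

      -- For t > m the predecessor of t has not been moved. The only new case is t = m, where
      -- `pred t` belongs to the rearranged part.
      twisted-long : ∀ {t} → m ≤ t → g (pred t) ≢ t → twisted (pred m) ≢ m → twisted (pred t) ≢ t
      twisted-long {t} m≤t long short e with m ≤? pred t
      ... | yes le = long (trans (sym (to-large≡ (subst (m ≤_) (trans (sym e) (twisted-large le)) m≤t))) (trans (sym (twisted-large le)) e))
      ... | no nle = short (subst (λ z → twisted (pred z) ≡ z) (≤-antisym (t≤m t (≰⇒> nle)) m≤t) e)
        where
        t≤m : ∀ t → pred t < m → t ≤ m
        t≤m zero _ = z≤n
        t≤m (suc t) lt = lt

Goal : ∀ {n} → F n → Set
Goal {n} f = ∃ λ (h : F n) → (h ∼ f) × SmallAttractor h

goal : ∀ {n} {f : F n} {g} → (∀ x → f x ≢ x) → Labelled f g → (∀ p → p < pow n → Reach n g p) → OriginClosure n g → Goal f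
goal {n} {f} {g} nofix ℓ all C = network n g , network-∼ ℓ , small-attractor {n} {g} all nofix' C
  where
  open Labelled ℓ
  nofix' : ∀ p → p < pow n → g p ≢ p
  nofix' p p< e = nofix (unl p) (trans (sym (unl-lab _)) (cong unl (trans (commutes _) (trans (cong g (lab-unl p<)) e))))

flip-to : ∀ n (g : ℕ → ℕ) p p' {q} → g p ≡ q → Flip n p q p' → Flip n p (g p) p'
flip-to n g p p' e fl = subst (λ z → Flip n p z p') (sym e) fl

closed-at : ∀ n (g : ℕ → ℕ) (R : List ℕ) r {q} → g r ≡ q →
  (∀ i → (¬ bits n q ‼ i ≡ bits n r ‼ i) → ∃ λ r' → r' ∈ R × flip i (bits n r) ≡ bits n r') →
  ∀ i → (¬ bits n (g r) ‼ i ≡ bits n r ‼ i) → ∃ λ r' → r' ∈ R × flip i (bits n r) ≡ bits n r'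
closed-at n g R r e c i ne = c i (λ eq → ne (trans (cong (λ z → bits n z ‼ i) e) eq))

8≤pow : ∀ k → 8 ≤ pow (3 + k)
8≤pow k = double-mono-≤ {4} (double-mono-≤ {2} (double-mono-≤ {1} (subst (1 ≤_) (sym (pow≡1+top k)) (s≤s z≤n))))

4≤pow : ∀ k → 4 ≤ pow (2 + k)
4≤pow k = double-mono-≤ {2} (double-mono-≤ {1} (subst (1 ≤_) (sym (pow≡1+top k)) (s≤s z≤n)))

literal< : ∀ {a b c} {w : True (a <? b)} → b ≤ c → a < c
literal< {w = w} le = <-≤-trans (toWitness w) le

top-bit : ∀ n i → bits n (top n) ‼ i ≡ true
top-bit (suc n) zero = odd-join true (top n)
top-bit (suc n) (suc i) = trans (cong (λ z → bits n z ‼ i) (half-join true (top n))) (top-bit n i)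

-- In bits: 0 ↦ 3 leads to 1 and 2 only, 1 ↦ 0 leads back, 2 ↦ 4 leads to 0 and 6 only, and 6 ↦ 2
-- leads to 2.
path-core : ∀ {k g} → g 0 ≡ 3 → g 1 ≡ 0 → g 2 ≡ 4 → g 6 ≡ 2 → OriginClosure (3 + k) g
path-core {k} {g} e0 e1 e2 e6 = record
  { R = 0 ∷ 1 ∷ 2 ∷ 6 ∷ [] ; zero∈ = here refl ; R≤4 = ≤-refl ; R< = R< ; R-path = path ; R-closed = closed }
  where
  n = 3 + k
  R = 0 ∷ 1 ∷ 2 ∷ 6 ∷ []
  R< : ∀ {r} → r ∈ R → r < pow n
  R< (here refl) = literal< (8≤pow k)
  R< (there (here refl)) = literal< (8≤pow k)
  R< (there (there (here refl))) = literal< (8≤pow k)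
  R< (there (there (there (here refl)))) = literal< (8≤pow k)
  to2 : Path n g 0 2
  to2 = done then (literal< (8≤pow k) , flip-to n g 0 2 e0 (suc zero , (λ ()) , refl))
  path : ∀ {r} → r ∈ R → Path n g 0 r
  path (here refl) = done
  path (there (here refl)) = done then (literal< (8≤pow k) , flip-to n g 0 1 e0 (zero , (λ ()) , refl))
  path (there (there (here refl))) = to2
  path (there (there (there (here refl)))) = to2 then (literal< (8≤pow k) , flip-to n g 2 6 e2 (suc (suc zero) , (λ ()) , refl))
  closed : ∀ {r} → r ∈ R → ∀ i → (¬ bits n (g r) ‼ i ≡ bits n r ‼ i) → ∃ λ r' → r' ∈ R × flip i (bits n r) ≡ bits n r'
  closed (here refl) = closed-at n g R 0 e0 λ
    { zero _ → 1 , there (here refl) , refl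
    ; (suc zero) _ → 2 , there (there (here refl)) , refl
    ; (suc (suc zero)) ne → ⊥-elim (ne refl)
    ; (suc (suc (suc i))) ne → ⊥-elim (ne refl) }
  closed (there (here refl)) = closed-at n g R 1 e1 λ
    { zero _ → 0 , here refl , refl
    ; (suc zero) ne → ⊥-elim (ne refl)
    ; (suc (suc zero)) ne → ⊥-elim (ne refl)
    ; (suc (suc (suc i))) ne → ⊥-elim (ne refl) }
  closed (there (there (here refl))) = closed-at n g R 2 e2 λ
    { zero ne → ⊥-elim (ne refl)
    ; (suc zero) _ → 0 , here refl , refl
    ; (suc (suc zero)) _ → 6 , there (there (there (here refl))) , refl
    ; (suc (suc (suc i))) ne → ⊥-elim (ne refl) }
  closed (there (there (there (here refl)))) = closed-at n g R 6 e6 λ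
    { zero ne → ⊥-elim (ne refl)
    ; (suc zero) ne → ⊥-elim (ne refl)
    ; (suc (suc zero)) _ → 2 , there (there (here refl)) , refl
    ; (suc (suc (suc i))) ne → ⊥-elim (ne refl) }

-- From 0 the arcs lead to 1 and 2, and both return. No swaps are made here: `descends` says that no
-- start remains from position 4 on.
star-goal : ∀ {k} {f : F (2 + k)} {g} → (∀ x → f x ≢ x) → Labelled f g → g 0 ≡ 3 → g 1 ≡ 0 → g 2 ≡ 0 →
  g 3 ≡ 1 ⊎ g 3 ≡ 4 ⊎ g 3 ≡ 5 → (∀ x → 4 ≤ x → x < pow (2 + k) → g x ≤ x) → Goal f
star-goal {k} {f} {g} nofix ℓ e0 e1 e2 e3 descends = goal {g = g} nofix ℓ all
    record { R = R ; zero∈ = here refl ; R≤4 = s≤s (s≤s (s≤s z≤n)) ; R< = R< ; R-path = path ; R-closed = closed }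
  where
  n = 2 + k
  R = 0 ∷ 1 ∷ 2 ∷ []
  R< : ∀ {r} → r ∈ R → r < pow n
  R< (here refl) = literal< (4≤pow k)
  R< (there (here refl)) = literal< (4≤pow k)
  R< (there (there (here refl))) = literal< (4≤pow k)
  path : ∀ {r} → r ∈ R → Path n g 0 r
  path (here refl) = done
  path (there (here refl)) = done then (literal< (4≤pow k) , flip-to n g 0 1 e0 (zero , (λ ()) , refl))
  path (there (there (here refl))) = done then (literal< (4≤pow k) , flip-to n g 0 2 e0 (suc zero , (λ ()) , refl))
  closed : ∀ {r} → r ∈ R → ∀ i → (¬ bits n (g r) ‼ i ≡ bits n r ‼ i) → ∃ λ r' → r' ∈ R × flip i (bits n r) ≡ bits n r'
  closed (here refl) = closed-at n g R 0 e0 λ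
    { zero _ → 1 , there (here refl) , refl
    ; (suc zero) _ → 2 , there (there (here refl)) , refl
    ; (suc (suc i)) ne → ⊥-elim (ne refl) }
  closed (there (here refl)) = closed-at n g R 1 e1 λ
    { zero _ → 0 , here refl , refl
    ; (suc zero) ne → ⊥-elim (ne refl)
    ; (suc (suc i)) ne → ⊥-elim (ne refl) }
  closed (there (there (here refl))) = closed-at n g R 2 e2 λ
    { zero ne → ⊥-elim (ne refl)
    ; (suc zero) _ → 0 , here refl , refl
    ; (suc (suc i)) ne → ⊥-elim (ne refl) }
  reach1 : Reach n g 1
  reach1 = step {p' = 0} (flip-to n g 1 0 e1 (zero , (λ ()) , refl)) (literal< (4≤pow k)) origin
  reach2 : Reach n g 2
  reach2 = step {p' = 0} (flip-to n g 2 0 e2 (suc zero , (λ ()) , refl)) (literal< (4≤pow k)) origin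
  reach3 : g 3 ≡ 1 ⊎ g 3 ≡ 4 ⊎ g 3 ≡ 5 → Reach n g 3
  -- None of 1, 4 and 5 has the bit of weight 2, so in each case 3 may drop it and become 1.
  reach3 (inj₁ e) = step {p' = 1} (flip-to n g 3 1 e (suc zero , (λ ()) , refl)) (literal< (4≤pow k)) reach1
  reach3 (inj₂ (inj₁ e)) = step {p' = 1} (flip-to n g 3 1 e (suc zero , (λ ()) , refl)) (literal< (4≤pow k)) reach1
  reach3 (inj₂ (inj₂ e)) = step {p' = 1} (flip-to n g 3 1 e (suc zero , (λ ()) , refl)) (literal< (4≤pow k)) reach1
  small-even : ∀ x → x < 4 → odd x ≡ false → Reach n g x
  small-even 0 _ _ = origin
  small-even 2 _ _ = reach2
  small-even (suc (suc (suc (suc _)))) (s≤s (s≤s (s≤s (s≤s ())))) _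
  small-odd : ∀ x → x < 4 → x < pow n → odd x ≡ true → Reach n g x
  small-odd 1 _ _ _ = reach1
  small-odd 3 _ _ _ = reach3 e3
  small-odd (suc (suc (suc (suc _)))) (s≤s (s≤s (s≤s (s≤s ())))) _ _
  all : ∀ p → p < pow n → Reach n g p
  all = reach-all n g 4 (reach-even n g 4 small-even (λ x le x< _ → descends x le x<)) small-odd (λ x le x< _ → inj₁ (descends x le x<))

sorted-long : ∀ {n g} → Sorted (pow n) g → (∀ p → p < pow n → g (g p) ≢ p) → g (pred (top n)) ≢ top n
sorted-long {n} {g} S no2 e = bad (top n) refl
  where
  bad : ∀ t → top n ≡ t → ⊥
  bad zero eq = no2 (pred (top n)) (p< eq) (trans (cong g e) (trans (cong g (sym (trans (cong pred eq) (sym eq)))) (trans e (trans eq (sym (cong pred eq))))))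
    where
    p< : top n ≡ 0 → pred (top n) < pow n
    p< eq = subst (_< pow n) (sym (cong pred eq)) (subst (0 <_) (sym (pow≡1+top n)) (s≤s z≤n))
  bad (suc t) eq = no2 t t< (trans (cong g (trans (cong g (sym (cong pred eq))) (trans e eq))) (suc-injective (Sorted.contiguous S t (suc t) t< ≤-refl (≤-reflexive (sym (trans (cong g (sym (cong pred eq))) (trans e eq)))))))
    where
    t< : t < pow n
    t< = subst (t <_) (sym (trans (pow≡1+top n) (cong suc eq))) (<-trans ≤-refl ≤-refl)

-- The attractor will be the path 1 - 0 - 2 - 6, the reason being 1 ↦ 0 ↦ 3 and 6 ↦ 2 ↦ 4; the values
-- at 3, 4 and 5 only have to lead back to it.
record PathLayout {k : ℕ} (f : F (3 + k)) : Set where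
  field
    nofix : ∀ x → f x ≢ x
    g : ℕ → ℕ
    labelled : Labelled f g
    m : ℕ
    m-odd : odd m ≡ true
    7≤m : 7 ≤ m
    blocks : Blocks (pow (3 + k)) m g
    long : g (pred (top (3 + k))) ≢ top (3 + k)
    at0 : g 0 ≡ 3
    at1 : g 1 ≡ 0
    at2 : g 2 ≡ 4
    at6 : g 6 ≡ 2
    at4 : g 4 ≡ 1 ⊎ g 4 ≡ 6 ⊎ g 4 ≡ 7 ⊎ g 4 ≡ 8
    at5 : g 5 < 5 ⊎ g 5 ≡ 6 ⊎ (m ≡ 7 × 7 ≤ g 5 × (g 5 ≡ top (3 + k) → 9 < pow (3 + k)))
    at3 : g 3 ≡ 1 ⊎ g 3 ≡ 5 ⊎ g 3 ≡ 6 ⊎ g 3 ≡ 9 ⊎ (m ≡ 7 × 7 ≤ g 3 × g 7 ≡ 5)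
    middle : ∀ x → 7 ≤ x → x < m → g x < x

module _ {k : ℕ} {f : F (3 + k)} (P : PathLayout f) where
  open PathLayout P

  private
    n = 3 + k
    open Swap n m g m-odd blocks renaming (g' to g₂)
    8≤N = 8≤pow k

    arc : ∀ p p' {q} → g₂ p ≡ q → Flip n p q p' → Flip n p (g₂ p) p'
    arc = flip-to n g₂

    g₂≡ : ∀ {x q} → x < m → g x ≡ q → q < m → g₂ x ≡ q
    g₂≡ x<m e q<m = trans (g'-small x<m) (trans (cong σ e) (σ-small q<m))

    small≡ : ∀ {x q} {x<7 : True (x <? 7)} {q<7 : True (q <? 7)} → g x ≡ q → g₂ x ≡ q
    small≡ {x<7 = a} {b} e = g₂≡ (literal< {w = a} 7≤m) e (literal< {w = b} 7≤m)

    reach1 : Reach n g₂ 1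
    reach1 = step {p' = 0} (arc 1 0 (small≡ at1) (zero , (λ ()) , refl)) (literal< 8≤N) origin
    reach2 : Reach n g₂ 2
    reach2 = step {p' = 0} (arc 2 0 (small≡ at2) (suc zero , (λ ()) , refl)) (literal< 8≤N) origin
    reach6 : Reach n g₂ 6
    reach6 = step {p' = 2} (arc 6 2 (small≡ at6) (suc (suc zero) , (λ ()) , refl)) (literal< 8≤N) reach2

    value4 : g₂ 4 ≡ 1 ⊎ g₂ 4 ≡ 6 ⊎ g₂ 4 ≡ 7 ⊎ g₂ 4 ≡ 8
    value4 with at4
    ... | inj₁ e = inj₁ (small≡ e)
    ... | inj₂ (inj₁ e) = inj₂ (inj₁ (small≡ e))
    ... | inj₂ (inj₂ (inj₁ e)) with σ 7 | σ-view 7 | trans (g'-small {4} (literal< 7≤m)) (cong σ e)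
    ...   | _ | odd-keep _ _ | e' = inj₂ (inj₂ (inj₁ e'))
    ...   | _ | odd-up _ _ | e' = inj₂ (inj₂ (inj₂ e'))
    value4 | inj₂ (inj₂ (inj₂ e)) with σ 8 | σ-view 8 | trans (g'-small {4} (literal< 7≤m)) (cong σ e)
    ...   | _ | even-keep _ _ | e' = inj₂ (inj₂ (inj₂ e'))
    ...   | _ | even-down _ _ | e' = inj₂ (inj₂ (inj₁ e'))

    reach4 : Reach n g₂ 4
    reach4 with value4
    ... | inj₁ e = step {p' = 0} (arc 4 0 e (suc (suc zero) , (λ ()) , refl)) (literal< 8≤N) origin
    ... | inj₂ (inj₁ e) = step {p' = 6} (arc 4 6 e (suc zero , (λ ()) , refl)) (literal< 8≤N) reach6
    ... | inj₂ (inj₂ (inj₁ e)) = step {p' = 6} (arc 4 6 e (suc zero , (λ ()) , refl)) (literal< 8≤N) reach6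
    ... | inj₂ (inj₂ (inj₂ e)) = step {p' = 0} (arc 4 0 e (suc (suc zero) , (λ ()) , refl)) (literal< 8≤N) origin

    small-even : ∀ x → x < 7 → odd x ≡ false → Reach n g₂ x
    small-even 0 _ _ = origin
    small-even 2 _ _ = reach2
    small-even 4 _ _ = reach4
    small-even 6 _ _ = reach6
    small-even (suc (suc (suc (suc (suc (suc (suc _))))))) (s≤s (s≤s (s≤s (s≤s (s≤s (s≤s (s≤s ()))))))) _

    middle≤ : ∀ x → 7 ≤ x → x < m → g₂ x ≤ x
    middle≤ x le x<m = ≤-trans (≤-reflexive (g₂≡ x<m refl (<-trans (middle x le x<m) x<m))) (<⇒≤ (middle x le x<m))

    evens : ∀ x → x < pow n → odd x ≡ false → Reach n g₂ x
    evens = reach-even n g₂ 7 small-even large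
      where
      large : ∀ x → 7 ≤ x → x < pow n → odd x ≡ false → g₂ x ≤ x
      large x le x< o with x <? m
      ... | yes x<m = middle≤ x le x<m
      ... | no x≮m = even-descends x (≮⇒≥ x≮m) x< o

    to-even : ∀ p → suc p < pow n → odd p ≡ false → odd (g₂ (suc p)) ≡ false → Reach n g₂ (suc p)
    to-even p p< o e = step (flip-odd n p< o e) (<-trans ≤-refl p<) (evens p (<-trans ≤-refl p<) o)

    5-low : ∀ q → q < 4 → g₂ 5 ≡ q → Flip n 5 (g₂ 5) 1
    5-low 0 _ e = arc 5 1 e (suc (suc zero) , (λ ()) , refl)
    5-low 1 _ e = arc 5 1 e (suc (suc zero) , (λ ()) , refl)
    5-low 2 _ e = arc 5 1 e (suc (suc zero) , (λ ()) , refl)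
    5-low 3 _ e = arc 5 1 e (suc (suc zero) , (λ ()) , refl)
    5-low (suc (suc (suc (suc _)))) (s≤s (s≤s (s≤s (s≤s ())))) _

    reach5 : Reach n g₂ 5
    reach5 with at5
    ... | inj₂ (inj₁ e) = to-even 4 (literal< 8≤N) refl (cong odd (small≡ {5} {6} e))
    ... | inj₁ l with m≤n⇒m<n∨m≡n (≤-pred l)
    ...   | inj₁ l' = step (5-low (g 5) l' (g₂≡ {5} (literal< 7≤m) refl (<-≤-trans l (≤-trans (from-yes (5 ≤? 7)) 7≤m)))) (literal< 8≤N) reach1
    ...   | inj₂ e = to-even 4 (literal< 8≤N) refl (cong odd (small≡ {5} {4} e))
    reach5 | inj₂ (inj₂ (m≡7 , 7≤ , room)) = start (end-even {5} (literal< 8≤N) (literal< 7≤) (subst (_≤ g 5) (sym m≡7) 7≤))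
      where
      start : odd (σ (g 5)) ≡ false ⊎ (g 5 ≡ top n × σ (g 5) ≡ top n) → Reach n g₂ 5
      start (inj₁ e) = to-even 4 (literal< 8≤N) refl (trans (cong odd (g'-small {5} (literal< 7≤m))) e)
      -- Here x + 1 = 6 is still below m = 7, so the jump by 4 has to exist: `room` supplies 9 < N.
      start (inj₂ (e , e')) = reach-from-last evens long {5} {5} refl (literal< 8≤N) (literal< 8≤N) (literal< 7≤) ≤-refl (n≤1+n _)
            (≤-reflexive m≡7) (inj₂ (room e)) e (trans (g'-small {5} (literal< 7≤m)) e')

    -- The end has all bits one, so 3 may rise to 7; the image 5 of 7 lacks the bit of weight 2, so
    -- 7 may go to 5. Position 7 keeps its vertex because it lies inside the block of 3.
    reach3-top : m ≡ 7 → 7 ≤ g 3 → g 7 ≡ 5 → g 3 ≡ top n → σ (g 3) ≡ top n → Reach n g₂ 3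
    reach3-top m≡7 7≤ g7 e e' =
      step {p' = 7} (arc 3 7 (trans (g'-small {3} (literal< 7≤m)) e') (suc (suc zero) , (λ eq → true≢false (trans (sym (top-bit n (suc (suc zero)))) eq)) , refl)) (literal< 8≤N)
        (step {p' = 5} (arc 7 5 g₂7 (suc zero , (λ ()) , refl)) (literal< 8≤N) reach5)
      where
      8≤g3 : 8 < pow n → 8 ≤ g 3
      8≤g3 l = subst (8 ≤_) (sym e) (≤-pred (subst (8 <_) (pow≡1+top n) l))
      ns : ¬ Sw 7
      ns (_ , l , inj₁ st) = <-asym st (Blocks.inner-descends blocks 3 8 (literal< 8≤N) (from-yes (3 <? 8)) (subst (_≤ 8) (sym m≡7) (n≤1+n 7)) (8≤g3 l))
      ns (m≤7 , l , inj₂ (p , p< , ep)) = no-end-inside {3} (literal< 8≤N) (from-yes (3 ≤? 7)) (8≤g3 l) m≤7 p< ep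
      g₂7 : g₂ 7 ≡ 5
      g₂7 = trans (cong (λ z → σ (g z)) (View⇒≡ (odd-keep refl ns))) (trans (cong σ g7) (σ-small {5} (literal< 7≤m)))

    -- The images 1, 5 and 9 lack the bit of weight 2, which sends 3 to 1. An even image, such as 6
    -- or the 10 that `σ` may put for 9, sends 3 to 2.
    reach3 : Reach n g₂ 3
    reach3 with at3
    ... | inj₁ e = step {p' = 1} (arc 3 1 (small≡ {3} {1} e) (suc zero , (λ ()) , refl)) (literal< 8≤N) reach1
    ... | inj₂ (inj₁ e) = step {p' = 1} (arc 3 1 (small≡ {3} {5} e) (suc zero , (λ ()) , refl)) (literal< 8≤N) reach1
    ... | inj₂ (inj₂ (inj₁ e)) = to-even 2 (literal< 8≤N) refl (cong odd (small≡ {3} {6} e))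
    ... | inj₂ (inj₂ (inj₂ (inj₁ e))) with σ 9 | σ-view 9 | trans (g'-small {3} (literal< 7≤m)) (cong σ e)
    ...   | _ | odd-keep _ _ | e' = step {p' = 1} (arc 3 1 e' (suc zero , (λ ()) , refl)) (literal< 8≤N) reach1
    ...   | _ | odd-up _ _ | e' = to-even 2 (literal< 8≤N) refl (cong odd e')
    reach3 | inj₂ (inj₂ (inj₂ (inj₂ (m≡7 , 7≤ , g7)))) with end-even {3} (literal< 8≤N) (literal< 7≤) (subst (_≤ g 3) (sym m≡7) 7≤)
    ... | inj₁ e = to-even 2 (literal< 8≤N) refl (trans (cong odd (g'-small {3} (literal< 7≤m))) e)
    ... | inj₂ (e , e') = reach3-top m≡7 7≤ g7 e e'

    small-odd : ∀ x → x < 7 → x < pow n → odd x ≡ true → Reach n g₂ x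
    small-odd 1 _ _ _ = reach1
    small-odd 3 _ _ _ = reach3
    small-odd 5 _ _ _ = reach5
    small-odd (suc (suc (suc (suc (suc (suc (suc _))))))) (s≤s (s≤s (s≤s (s≤s (s≤s (s≤s (s≤s ()))))))) _ _

    all : ∀ p → p < pow n → Reach n g₂ p
    all = reach-all n g₂ 7 evens small-odd large
      where
      large : ∀ x → 7 ≤ x → x < pow n → odd x ≡ true → g₂ x ≤ x ⊎ odd (g₂ x) ≡ false ⊎ Reach n g₂ x
      large x le x< o with x <? m
      ... | yes x<m = inj₁ (middle≤ x le x<m)
      ... | no x≮m = odd-descends evens long x (≮⇒≥ x≮m) x< o

  path-goal : Goal f
  path-goal = goal nofix (relabel σ-perm labelled) all (path-core (small≡ at0) (small≡ at1) (small≡ at2) (small≡ at6))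

pred-step : ∀ {N g} → Sorted N g → ∀ {p e} r → p < N → g p ≡ e → p < suc r → suc r ≤ e → g (suc r) ≡ r
pred-step S {p} r p<N e p<r r≤ = suc-injective (Sorted.contiguous S p (suc r) p<N p<r (subst (suc r ≤_) (sym e) r≤))

-- Layouts with two disjoint paths of three vertices

module PathCases {k : ℕ} {f : F (3 + k)} (nofix : ∀ x → f x ≢ x) (g : ℕ → ℕ) (S : Sorted (pow (3 + k)) g) (ℓ : Labelled f g)
  (no2 : ∀ p → p < pow (3 + k) → g (g p) ≢ p) where

  private
    n = 3 + k
    N = pow n
    8≤N = 8≤pow k

    m≤top : ∀ {m} → odd m ≡ true → m ≤ N → m ≤ top n
    m≤top {m} o le with m≤n⇒m<n∨m≡n le
    ... | inj₁ l = ≤-pred (subst (m <_) (pow≡1+top n) l)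
    ... | inj₂ refl = ⊥-elim (odd≢even {N} o (odd-double (pow (2 + k))))

    wide : ∀ k → top (3 + k) ≢ 7 → 9 < pow (3 + k)
    wide zero ne = ⊥-elim (ne refl)
    wide (suc k) _ = ≤-trans (from-yes (10 ≤? 16)) (double-mono-≤ (8≤pow k))

    -- For `top n` = 7 the vertices 6 and 7 would form a two-cycle; the next possible N is 16.
    ascent6 : g 6 ≡ top n → 9 < N
    ascent6 e = wide k (λ t≡7 → sorted-long S no2 (trans (cong (λ z → g (pred z)) t≡7) e))

    6-moves : g 6 < 6 ⊎ 7 ≤ g 6
    6-moves with g 6 <? 6
    ... | yes l = inj₁ l
    ... | no nl with m≤n⇒m<n∨m≡n (≮⇒≥ nl)
    ...   | inj₁ l = inj₂ l
    ...   | inj₂ e = ⊥-elim (no2 6 (literal< 8≤N) (trans (cong g (sym e)) (sym e)))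

    layout : (m : ℕ) (xs ys : List ℕ) → length xs ≡ m → length ys ≡ m → Inverse m xs ys → m ≤ N → odd m ≡ true → 7 ≤ m →
      (let g₁ = λ x → table xs (g (table ys x))) →
      g₁ (pred m) ≢ m → g₁ 0 ≡ 3 → g₁ 1 ≡ 0 → g₁ 2 ≡ 4 → g₁ 6 ≡ 2 → g₁ 4 ≡ 1 ⊎ g₁ 4 ≡ 6 ⊎ g₁ 4 ≡ 7 ⊎ g₁ 4 ≡ 8 →
      g₁ 5 < 5 ⊎ g₁ 5 ≡ 6 ⊎ (m ≡ 7 × 7 ≤ g₁ 5 × (g₁ 5 ≡ top n → 9 < pow n)) →
      g₁ 3 ≡ 1 ⊎ g₁ 3 ≡ 5 ⊎ g₁ 3 ≡ 6 ⊎ g₁ 3 ≡ 9 ⊎ (m ≡ 7 × 7 ≤ g₁ 3 × g₁ 7 ≡ 5) →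
      (∀ x → 7 ≤ x → x < m → g₁ x < x) → Goal f
    layout m xs ys xl yl inv m≤N o 7≤m short e0 e1 e2 e6 e4 e5 e3 mid = path-goal record
      { nofix = nofix ; g = twisted g ; labelled = relabel τ ℓ ; m = m ; m-odd = o ; 7≤m = 7≤m
      ; blocks = blocks g S ; long = twisted-long g S (m≤top o m≤N) (sorted-long S no2) short
      ; at0 = e0 ; at1 = e1 ; at2 = e2 ; at6 = e6 ; at4 = e4 ; at5 = e5 ; at3 = e3 ; middle = mid }
      where open Twist N m xs ys xl yl inv m≤N

    layout7 : (xs ys : List ℕ) → length xs ≡ 7 → length ys ≡ 7 → Inverse 7 xs ys →
      (let g₁ = λ x → table xs (g (table ys x))) →
      g₁ 0 ≡ 3 → g₁ 1 ≡ 0 → g₁ 2 ≡ 4 → g₁ 6 ≡ 2 → g₁ 4 ≡ 1 ⊎ g₁ 4 ≡ 6 ⊎ g₁ 4 ≡ 7 ⊎ g₁ 4 ≡ 8 →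
      g₁ 5 < 5 ⊎ g₁ 5 ≡ 6 ⊎ (7 ≤ g₁ 5 × (g₁ 5 ≡ top n → 9 < pow n)) →
      g₁ 3 ≡ 1 ⊎ g₁ 3 ≡ 5 ⊎ g₁ 3 ≡ 6 ⊎ (7 ≤ g₁ 3 × g₁ 7 ≡ 5) → Goal f
    layout7 xs ys xl yl inv e0 e1 e2 e6 e4 e5 e3 =
      layout 7 xs ys xl yl inv (≤-trans (n≤1+n 7) 8≤N) refl ≤-refl (λ e → 2≢7 (trans (sym e6) e)) e0 e1 e2 e6 e4 (v5 e5) (v3 e3)
        (λ x le x< → ⊥-elim (<⇒≱ x< le))
      where
      g₁ : ℕ → ℕ
      g₁ x = table xs (g (table ys x))
      2≢7 : 2 ≢ 7
      2≢7 ()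
      v5 : g₁ 5 < 5 ⊎ g₁ 5 ≡ 6 ⊎ (7 ≤ g₁ 5 × (g₁ 5 ≡ top n → 9 < pow n)) → g₁ 5 < 5 ⊎ g₁ 5 ≡ 6 ⊎ (7 ≡ 7 × 7 ≤ g₁ 5 × (g₁ 5 ≡ top n → 9 < pow n))
      v5 (inj₁ a) = inj₁ a
      v5 (inj₂ (inj₁ a)) = inj₂ (inj₁ a)
      v5 (inj₂ (inj₂ a)) = inj₂ (inj₂ (refl , a))
      v3 : g₁ 3 ≡ 1 ⊎ g₁ 3 ≡ 5 ⊎ g₁ 3 ≡ 6 ⊎ (7 ≤ g₁ 3 × g₁ 7 ≡ 5) → g₁ 3 ≡ 1 ⊎ g₁ 3 ≡ 5 ⊎ g₁ 3 ≡ 6 ⊎ g₁ 3 ≡ 9 ⊎ (7 ≡ 7 × 7 ≤ g₁ 3 × g₁ 7 ≡ 5)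
      v3 (inj₁ a) = inj₁ a
      v3 (inj₂ (inj₁ a)) = inj₂ (inj₁ a)
      v3 (inj₂ (inj₂ (inj₁ a))) = inj₂ (inj₂ (inj₁ a))
      v3 (inj₂ (inj₂ (inj₂ a))) = inj₂ (inj₂ (inj₂ (inj₂ (refl , a))))

    beyond7 : ∀ xs → length xs ≡ 7 → ∀ {p} → 7 ≤ p → table xs p ≡ p
    beyond7 xs e {p} le = table-beyond xs (subst (_≤ p) (sym e) le)

    -- position 5 receives vertex 6
    value5 : ∀ xs → length xs ≡ 7 → (∀ j → j < 6 → table xs j < 5 ⊎ table xs j ≡ 6) →
      table xs (g 6) < 5 ⊎ table xs (g 6) ≡ 6 ⊎ (7 ≤ table xs (g 6) × (table xs (g 6) ≡ top n → 9 < pow n))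
    value5 xs e small with 6-moves
    ... | inj₂ l = inj₂ (inj₂ (subst (7 ≤_) (sym (beyond7 xs e l)) l , λ e' → ascent6 (trans (sym (beyond7 xs e l)) e')))
    ... | inj₁ l with small (g 6) l
    ...   | inj₁ a = inj₁ a
    ...   | inj₂ b = inj₂ (inj₁ b)

    five-or-more : ∀ {x} → 5 ≤ x → x ≡ 5 ⊎ x ≡ 6 ⊎ 7 ≤ x
    five-or-more {x} le with m≤n⇒m<n∨m≡n le
    ... | inj₂ e = inj₁ (sym e)
    ... | inj₁ l with m≤n⇒m<n∨m≡n l
    ...   | inj₂ e = inj₂ (inj₁ (sym e))
    ...   | inj₁ l' = inj₂ (inj₂ l')

    -- position 3 receives the first vertex y of a block that extends at least to vertex 5
    value3 : ∀ xs ys → length xs ≡ 7 → length ys ≡ 7 → ∀ y → y < 7 → 5 ≤ g y → table xs 5 ≡ 1 ⊎ table xs 5 ≡ 6 → table xs 6 ≡ 5 →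
      (let g₁3 = table xs (g y)) → g₁3 ≡ 1 ⊎ g₁3 ≡ 5 ⊎ g₁3 ≡ 6 ⊎ (7 ≤ g₁3 × table xs (g (table ys 7)) ≡ 5)
    value3 xs ys xl yl y y<7 5≤ at5 at6 with five-or-more 5≤
    ... | inj₂ (inj₁ e) = inj₂ (inj₁ (trans (cong (table xs) e) at6))
    ... | inj₂ (inj₂ l) = inj₂ (inj₂ (inj₂ (subst (7 ≤_) (sym (beyond7 xs xl l)) l ,
            trans (cong (λ z → table xs (g z)) (beyond7 ys yl ≤-refl)) (trans (cong (table xs) (pred-step S {y} 6 (<-≤-trans y<7 (≤-trans (n≤1+n 7) 8≤N)) refl y<7 l)) at6))))
    ... | inj₁ e with at5
    ...   | inj₁ e' = inj₁ (trans (cong (table xs) e) e')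
    ...   | inj₂ e' = inj₂ (inj₂ (inj₁ (trans (cong (table xs) e) e')))

  -- One cycle carries both paths: the vertices 2, 1, 0 go to positions 1, 0, 3 and the vertices 5,
  -- 4, 3 to positions 6, 2, 4. Then 4 ↦ 1 comes for free, and position 5 takes the vertex 6.
  long-cycle : 5 ≤ g 0 → Goal f
  long-cycle 5≤ = layout7 xs ys refl refl (from-yes (inverse? 7 xs ys))
      (cong to (st 0 (s≤s z≤n))) (cong to (st 1 (s≤s (s≤s z≤n)))) (cong to (st 3 (from-yes (4 ≤? 5)))) (cong to (st 4 ≤-refl))
      (inj₁ (cong to (st 2 (from-yes (3 ≤? 5)))))
      (value5 xs refl small) (value3 xs ys refl refl 0 (s≤s z≤n) 5≤ (inj₂ refl) refl)
    where
    xs = 3 ∷ 0 ∷ 1 ∷ 4 ∷ 2 ∷ 6 ∷ 5 ∷ []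
    ys = 1 ∷ 2 ∷ 4 ∷ 0 ∷ 3 ∷ 6 ∷ 5 ∷ []
    to = table xs
    st : ∀ r → suc r ≤ 5 → g (suc r) ≡ r
    st r le = pred-step S r (literal< 8≤N) refl (s≤s z≤n) (≤-trans le 5≤)
    small : ∀ j → j < 6 → to j < 5 ⊎ to j ≡ 6
    small 0 _ = inj₁ (from-yes (3 <? 5))
    small 1 _ = inj₁ (from-yes (0 <? 5))
    small 2 _ = inj₁ (from-yes (1 <? 5))
    small 3 _ = inj₁ (from-yes (4 <? 5))
    small 4 _ = inj₁ (from-yes (2 <? 5))
    small 5 _ = inj₂ refl
    small (suc (suc (suc (suc (suc (suc _)))))) (s≤s (s≤s (s≤s (s≤s (s≤s (s≤s ()))))))

  -- The triangle 2, 1, 0 becomes 6 ↦ 2 ↦ 4 ↦ 6, and the beginning 5, 4, 3 of the second cycle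
  -- becomes 1 ↦ 0 ↦ 3.
  triangle-and-cycle : g 0 ≡ 2 → 5 ≤ g 3 → Goal f
  triangle-and-cycle g0 5≤ = layout7 xs ys refl refl (from-yes (inverse? 7 xs ys))
      (cong to (st' 3 ≤-refl (from-yes (4 ≤? 5)))) (cong to (st' 4 (from-yes (3 <? 5)) ≤-refl)) (cong to (st 0 (s≤s z≤n))) (cong to (st 1 ≤-refl))
      (inj₂ (inj₁ (cong to g0)))
      (value5 xs refl small) (value3 xs ys refl refl 3 (from-yes (3 <? 7)) 5≤ (inj₁ refl) refl)
    where
    xs = 4 ∷ 2 ∷ 6 ∷ 3 ∷ 0 ∷ 1 ∷ 5 ∷ []
    ys = 4 ∷ 5 ∷ 1 ∷ 3 ∷ 0 ∷ 6 ∷ 2 ∷ []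
    to = table xs
    st : ∀ r → suc r ≤ 2 → g (suc r) ≡ r
    st r le = pred-step S {0} r (literal< 8≤N) g0 (s≤s z≤n) le
    st' : ∀ r → 3 < suc r → suc r ≤ 5 → g (suc r) ≡ r
    st' r l le = pred-step S {3} r (literal< 8≤N) refl l (≤-trans le 5≤)
    small : ∀ j → j < 6 → to j < 5 ⊎ to j ≡ 6
    small 0 _ = inj₁ (from-yes (4 <? 5))
    small 1 _ = inj₁ (from-yes (2 <? 5))
    small 2 _ = inj₂ refl
    small 3 _ = inj₁ (from-yes (3 <? 5))
    small 4 _ = inj₁ (from-yes (0 <? 5))
    small 5 _ = inj₁ (from-yes (1 <? 5))
    small (suc (suc (suc (suc (suc (suc _)))))) (s≤s (s≤s (s≤s (s≤s (s≤s (s≤s ()))))))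

  -- The square becomes 5 ↦ 1 ↦ 0 ↦ 3 ↦ 5. The vertices 6, 5, 4 of the second cycle take positions
  -- 6, 2, 4, so that 4 is mapped to its end, 7 or 8.
  square-and-cycle : g 0 ≡ 3 → g 4 ≡ 7 ⊎ g 4 ≡ 8 → Goal f
  square-and-cycle g0 g4 = layout7 xs ys refl refl (from-yes (inverse? 7 xs ys))
      (cong to (st 0 (s≤s z≤n))) (cong to (st 1 (from-yes (2 ≤? 3)))) (cong to (st' 4 ≤-refl (from-yes (5 ≤? 7)))) (cong to (st' 5 (from-yes (4 <? 6)) (from-yes (6 ≤? 7))))
      (inj₂ (inj₂ (value g4)))
      (inj₁ (subst (_< 5) (sym (cong to (st 2 ≤-refl))) (from-yes (1 <? 5)))) (inj₂ (inj₁ (cong to g0)))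
    where
    xs = 3 ∷ 0 ∷ 1 ∷ 5 ∷ 4 ∷ 2 ∷ 6 ∷ []
    ys = 1 ∷ 2 ∷ 5 ∷ 0 ∷ 4 ∷ 3 ∷ 6 ∷ []
    to = table xs
    st : ∀ r → suc r ≤ 3 → g (suc r) ≡ r
    st r le = pred-step S {0} r (literal< 8≤N) g0 (s≤s z≤n) le
    7≤g4 : g 4 ≡ 7 ⊎ g 4 ≡ 8 → 7 ≤ g 4
    7≤g4 (inj₁ e) = ≤-reflexive (sym e)
    7≤g4 (inj₂ e) = ≤-trans (n≤1+n 7) (≤-reflexive (sym e))
    st' : ∀ r → 4 < suc r → suc r ≤ 7 → g (suc r) ≡ r
    st' r l le = pred-step S {4} r (literal< 8≤N) refl l (≤-trans le (7≤g4 g4))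
    value : g 4 ≡ 7 ⊎ g 4 ≡ 8 → to (g 4) ≡ 7 ⊎ to (g 4) ≡ 8
    value (inj₁ e) = inj₁ (cong to e)
    value (inj₂ e) = inj₂ (cong to e)

  -- Nine positions are arranged by hand: the first pentagon becomes 8 ↦ 7 ↦ 6 ↦ 2 ↦ 4 ↦ 8, and the
  -- second contributes 5 ↦ 1 ↦ 0 ↦ 3 ↦ 9, its end keeping the number 9.
  two-pentagons : 9 ≤ N → g 0 ≡ 4 → g 5 ≡ 9 → Goal f
  two-pentagons 9≤N g0 g5 = layout 9 xs ys refl refl (from-yes (inverse? 9 xs ys)) 9≤N refl (from-yes (7 ≤? 9))
      (λ ne → 7≢9 (trans (sym e8) ne))
      (cong to (st' 5 ≤-refl (from-yes (6 ≤? 9)))) (cong to (st' 6 (from-yes (5 <? 7)) (from-yes (7 ≤? 9)))) (cong to (st 0 (s≤s z≤n))) (cong to (st 1 (from-yes (2 ≤? 4))))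
      (inj₂ (inj₂ (inj₂ (cong to g0))))
      (inj₁ (subst (_< 5) (sym (cong to (st' 7 (from-yes (5 <? 8)) (from-yes (8 ≤? 9))))) (from-yes (1 <? 5)))) (inj₂ (inj₂ (inj₂ (inj₁ (cong to g5))))) middle
    where
    xs = 4 ∷ 2 ∷ 6 ∷ 7 ∷ 8 ∷ 3 ∷ 0 ∷ 1 ∷ 5 ∷ []
    ys = 6 ∷ 7 ∷ 1 ∷ 5 ∷ 0 ∷ 8 ∷ 2 ∷ 3 ∷ 4 ∷ []
    to = table xs
    st : ∀ r → suc r ≤ 4 → g (suc r) ≡ r
    st r le = pred-step S {0} r (literal< 8≤N) g0 (s≤s z≤n) le
    st' : ∀ r → 5 < suc r → suc r ≤ 9 → g (suc r) ≡ r
    st' r l le = pred-step S {5} r (literal< 8≤N) g5 l le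
    e8 : to (g 4) ≡ 7
    e8 = cong to (st 3 ≤-refl)
    7≢9 : 7 ≢ 9
    7≢9 ()
    middle : ∀ x → 7 ≤ x → x < 9 → to (g (table ys x)) < x
    middle x le x< with m≤n⇒m<n∨m≡n le
    ... | inj₂ refl = ≤-reflexive (cong suc (cong to (st 2 (from-yes (3 ≤? 4)))))
    ... | inj₁ l with ≤-antisym l (≤-pred x<)
    ...   | refl = ≤-reflexive (cong suc e8)

-- Layouts with a single cycle of length three, four or five

module StarCases {k : ℕ} {f : F (2 + k)} (nofix : ∀ x → f x ≢ x) (g : ℕ → ℕ) (S : Sorted (pow (2 + k)) g) (ℓ : Labelled f g) where

  private
    N = pow (2 + k)

    layout : (m : ℕ) (xs ys : List ℕ) → length xs ≡ m → length ys ≡ m → Inverse m xs ys → m ≤ N →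
      (let g₁ = λ x → table xs (g (table ys x))) →
      g₁ 0 ≡ 3 → g₁ 1 ≡ 0 → g₁ 2 ≡ 0 → g₁ 3 ≡ 1 ⊎ g₁ 3 ≡ 4 ⊎ g₁ 3 ≡ 5 →
      (∀ x → 4 ≤ x → x < m → g₁ x ≤ x) → (∀ x → m ≤ x → x < N → g x < x) → Goal f
    layout m xs ys xl yl inv m≤N e0 e1 e2 e3 small large =
      star-goal nofix (relabel τ ℓ) e0 e1 e2 e3 descends
      where
      open Twist N m xs ys xl yl inv m≤N
      descends : ∀ x → 4 ≤ x → x < N → twisted g x ≤ x
      descends x le x< with x <? m
      ... | yes x<m = small x le x<m
      ... | no x≮m = subst (_≤ x) (sym (twisted-large g (≮⇒≥ x≮m))) (<⇒≤ (to≤ g (≮⇒≥ x≮m) (large x (≮⇒≥ x≮m) x<)))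

    st : ∀ {e} → g 0 ≡ e → ∀ r → suc r ≤ e → g (suc r) ≡ r
    st e r le = pred-step S {0} r (literal< (4≤pow k)) e (s≤s z≤n) le

  -- The attached vertex has number 3 and shares the image 1 with vertex 2. The two go to positions
  -- 2 and 1, their image to 0 and vertex 0 to 3. The layouts for four and five vertices follow the
  -- same pattern, with the rest of the cycle behind position 3.
  triangle-star : g 0 ≡ 2 → g 3 ≡ 1 → (∀ x → 4 ≤ x → x < N → g x < x) → Goal f
  triangle-star g0 g3 trees = layout 4 xs ys refl refl (from-yes (inverse? 4 xs ys)) (4≤pow k)
      (cong to (st g0 0 (s≤s z≤n))) (cong to (st g0 1 ≤-refl)) (cong to g3) (inj₁ (cong to g0)) (λ x le x< → ⊥-elim (<⇒≱ x< le)) trees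
    where
    xs = 3 ∷ 0 ∷ 1 ∷ 2 ∷ []
    ys = 1 ∷ 2 ∷ 3 ∷ 0 ∷ []
    to = table xs

  square-star : 5 ≤ N → g 0 ≡ 3 → g 4 ≡ 1 → (∀ x → 5 ≤ x → x < N → g x < x) → Goal f
  square-star 5≤N g0 g4 trees = layout 5 xs ys refl refl (from-yes (inverse? 5 xs ys)) 5≤N
      (cong to (st g0 0 (s≤s z≤n))) (cong to (st g0 1 (from-yes (2 ≤? 3)))) (cong to g4) (inj₂ (inj₁ (cong to g0))) small trees
    where
    xs = 3 ∷ 0 ∷ 1 ∷ 4 ∷ 2 ∷ []
    ys = 1 ∷ 2 ∷ 4 ∷ 0 ∷ 3 ∷ []
    to = table xs
    small : ∀ x → 4 ≤ x → x < 5 → to (g (table ys x)) ≤ x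
    small x le x< with ≤-antisym le (≤-pred x<)
    ... | refl = ≤-trans (≤-reflexive (cong to (st g0 2 ≤-refl))) (from-yes (1 ≤? 4))

  pentagon-star : 6 ≤ N → g 0 ≡ 4 → g 5 ≡ 1 → (∀ x → 6 ≤ x → x < N → g x < x) → Goal f
  pentagon-star 6≤N g0 g5 trees = layout 6 xs ys refl refl (from-yes (inverse? 6 xs ys)) 6≤N
      (cong to (st g0 0 (s≤s z≤n))) (cong to (st g0 1 (from-yes (2 ≤? 4)))) (cong to g5) (inj₂ (inj₂ (cong to g0))) small trees
    where
    xs = 3 ∷ 0 ∷ 1 ∷ 4 ∷ 5 ∷ 2 ∷ []
    ys = 1 ∷ 2 ∷ 5 ∷ 0 ∷ 3 ∷ 4 ∷ []
    to = table xs
    small : ∀ x → 4 ≤ x → x < 6 → to (g (table ys x)) ≤ x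
    small x le x< with m≤n⇒m<n∨m≡n le
    ... | inj₂ refl = ≤-trans (≤-reflexive (cong to (st g0 2 (from-yes (3 ≤? 4))))) (from-yes (1 ≤? 4))
    ... | inj₁ l with ≤-antisym l (≤-pred x<)
    ...   | refl = ≤-trans (≤-reflexive (cong to (st g0 3 ≤-refl))) (n≤1+n 4)

-- Networks with a fixed point or a two-cycle, and very small networks

pair-core : ∀ {k g} → g 0 ≡ 2 → g 2 ≡ 0 → OriginClosure (2 + k) g
pair-core {k} {g} e0 e2 = record
  { R = R ; zero∈ = here refl ; R≤4 = s≤s (s≤s z≤n) ; R< = R< ; R-path = path ; R-closed = closed }
  where
  n = 2 + k
  R = 0 ∷ 2 ∷ []
  R< : ∀ {r} → r ∈ R → r < pow n
  R< (here refl) = literal< (4≤pow k)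
  R< (there (here refl)) = literal< (4≤pow k)
  path : ∀ {r} → r ∈ R → Path n g 0 r
  path (here refl) = done
  path (there (here refl)) = done then (literal< (4≤pow k) , flip-to n g 0 2 e0 (suc zero , (λ ()) , refl))
  closed : ∀ {r} → r ∈ R → ∀ i → (¬ bits n (g r) ‼ i ≡ bits n r ‼ i) → ∃ λ r' → r' ∈ R × flip i (bits n r) ≡ bits n r'
  closed (here refl) = closed-at n g R 0 e0 λ
    { zero ne → ⊥-elim (ne refl)
    ; (suc zero) _ → 2 , there (here refl) , refl
    ; (suc (suc i)) ne → ⊥-elim (ne refl) }
  closed (there (here refl)) = closed-at n g R 2 e2 λ
    { zero ne → ⊥-elim (ne refl)
    ; (suc zero) _ → 0 , here refl , refl
    ; (suc (suc i)) ne → ⊥-elim (ne refl) }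

sorted-blocks : ∀ {N g} → Sorted N g → Blocks N 1 g
sorted-blocks S = record
  { bound = bound
  ; inner-descends = λ p r p<N p<r _ r≤ → ≤-reflexive (contiguous p r p<N p<r r≤)
  ; crossing-unique = λ { zero zero _ _ _ _ _ _ → refl ; (suc _) _ (s≤s ()) _ _ _ _ _ ; zero (suc _) _ (s≤s ()) _ _ _ _ }
  ; inner-pred = λ p r p<N _ p<r r≤ → contiguous p r p<N (<-trans ≤-refl p<r) r≤ }
  where open Sorted S

module FromOrigin {n : ℕ} {f : F n} (g : ℕ → ℕ) (S : Sorted (pow n) g) (ℓ : Labelled f g) (long : g (pred (top n)) ≢ top n) where

  private
    open Swap n 1 g refl (sorted-blocks S)

    ℓ' : Labelled f g'
    ℓ' = relabel σ-perm ℓ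

    evens : ∀ x → x < pow n → odd x ≡ false → Reach n g' x
    evens = reach-even n g' 1 (λ { zero _ _ → origin ; (suc _) (s≤s ()) _ }) even-descends

    all : ∀ p → p < pow n → Reach n g' p
    all = reach-all n g' 1 evens (λ { zero _ _ () ; (suc _) (s≤s ()) _ _ }) (odd-descends evens long)

  fixed-goal : g 0 ≡ 0 → ∃ λ (h : F n) → (h ∼ f) × NumAttractors h (fp f)
  fixed-goal g0 = network n g' , network-∼ ℓ' , fixed-attractors all (trans (g'-small {0} (s≤s z≤n)) (trans (cong σ g0) (σ-small {0} (s≤s z≤n)))) ℓ'

  -- The end 1 of the first block is odd, so it is exchanged with 2. This gives 0 ↦ 2 ↦ 0, a
  -- two-cycle differing in one bit.
  two-cycle-goal : (∀ x → f x ≢ x) → g 0 ≡ 1 → (∃ λ k → n ≡ 2 + k) → Goal f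
  two-cycle-goal nofix g0 (k , refl) = goal nofix ℓ' all (pair-core e0 e2)
    where
    σ1 : σ 1 ≡ 2
    σ1 = View⇒≡ (odd-up refl (≤-refl , literal< (4≤pow k) , inj₂ (0 , s≤s z≤n , g0)))
    σ2 : σ 2 ≡ 1
    σ2 = trans (cong σ (sym σ1)) (σσ 1)
    e0 : g' 0 ≡ 2
    e0 = trans (g'-small {0} (s≤s z≤n)) (trans (cong σ g0) σ1)
    e2 : g' 2 ≡ 0
    e2 = trans (cong (λ z → σ (g z)) σ2) (trans (cong σ (pred-step S {0} 0 (literal< (4≤pow k)) g0 (s≤s z≤n) ≤-refl)) (σ-small {0} (s≤s z≤n)))

-- On two bits every configuration may belong to the attractor.
plane-goal : ∀ {f : F 2} {g} → (∀ x → f x ≢ x) → Labelled f g →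
  (∀ {r} → r < 4 → Path 2 g 0 r) → (∀ p → p < 4 → Reach 2 g p) → Goal f
plane-goal {f} {g} nofix ℓ paths all = goal nofix ℓ all
    record { R = R ; zero∈ = here refl ; R≤4 = ≤-refl ; R< = R< ; R-path = λ m → paths (R< m) ; R-closed = λ {r} _ i _ → total (flip i (bits 2 r)) }
  where
  R = 0 ∷ 1 ∷ 2 ∷ 3 ∷ []
  R< : ∀ {r} → r ∈ R → r < 4
  R< (here refl) = s≤s z≤n
  R< (there (here refl)) = s≤s (s≤s z≤n)
  R< (there (there (here refl))) = s≤s (s≤s (s≤s z≤n))
  R< (there (there (there (here refl)))) = ≤-refl
  total : ∀ x → ∃ λ r' → r' ∈ R × x ≡ bits 2 r'
  total (false ∷ false ∷ []) = 0 , here refl , refl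
  total (true ∷ false ∷ []) = 1 , there (here refl) , refl
  total (false ∷ true ∷ []) = 2 , there (there (here refl)) , refl
  total (true ∷ true ∷ []) = 3 , there (there (there (here refl))) , refl

-- The four-cycle is placed as the Gray code 0 ↦ 2 ↦ 3 ↦ 1 ↦ 0, so each of its steps is an arc of
-- the asynchronous graph.
square-goal : ∀ {f : F 2} {g} → (∀ x → f x ≢ x) → Sorted 4 g → Labelled f g → g 0 ≡ 3 → Goal f
square-goal {f} {g} nofix S ℓ g0 = plane-goal nofix (relabel τ ℓ) paths all
  where
  xs = 0 ∷ 1 ∷ 3 ∷ 2 ∷ []
  open Twist 4 4 xs xs refl refl (from-yes (inverse? 4 xs xs)) ≤-refl
  g₁ = twisted g
  st : ∀ r → suc r ≤ 3 → g (suc r) ≡ r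
  st r le = pred-step S {0} r (s≤s z≤n) g0 (s≤s z≤n) le
  e0 : g₁ 0 ≡ 2
  e0 = cong to g0
  e1 : g₁ 1 ≡ 0
  e1 = cong to (st 0 (s≤s z≤n))
  e3 : g₁ 3 ≡ 1
  e3 = cong to (st 1 (from-yes (2 ≤? 3)))
  e2 : g₁ 2 ≡ 3
  e2 = cong to (st 2 ≤-refl)
  arc02 = flip-to 2 g₁ 0 2 e0 (suc zero , (λ ()) , refl)
  arc23 = flip-to 2 g₁ 2 3 e2 (zero , (λ ()) , refl)
  arc31 = flip-to 2 g₁ 3 1 e3 (suc zero , (λ ()) , refl)
  arc10 = flip-to 2 g₁ 1 0 e1 (zero , (λ ()) , refl)
  to2 : Path 2 g₁ 0 2
  to2 = done then (from-yes (0 <? 4) , arc02)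
  to3 : Path 2 g₁ 0 3
  to3 = to2 then (from-yes (2 <? 4) , arc23)
  paths : ∀ {r} → r < 4 → Path 2 g₁ 0 r
  paths {0} _ = done
  paths {1} _ = to3 then (from-yes (3 <? 4) , arc31)
  paths {2} _ = to2
  paths {3} _ = to3
  paths {suc (suc (suc (suc _)))} (s≤s (s≤s (s≤s (s≤s ()))))
  r1 : Reach 2 g₁ 1
  r1 = step {p' = 0} arc10 (from-yes (0 <? 4)) origin
  r3 : Reach 2 g₁ 3
  r3 = step {p' = 1} arc31 (from-yes (1 <? 4)) r1
  all : ∀ p → p < 4 → Reach 2 g₁ p
  all 0 _ = origin
  all 1 _ = r1
  all 2 _ = step {p' = 3} arc23 (from-yes (3 <? 4)) r3
  all 3 _ = r3
  all (suc (suc (suc (suc _)))) (s≤s (s≤s (s≤s (s≤s ()))))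

-- The two-cycles are placed on antipodal pairs. Each configuration then maps to its complement, and
-- every flip is an arc.
two-pairs-goal : ∀ {f : F 2} {g} → (∀ x → f x ≢ x) → Sorted 4 g → Labelled f g → g 0 ≡ 1 → g 2 ≡ 3 → Goal f
two-pairs-goal {f} {g} nofix S ℓ g0 g2 = plane-goal nofix (relabel τ ℓ) paths all
  where
  xs = 0 ∷ 3 ∷ 1 ∷ 2 ∷ []
  ys = 0 ∷ 2 ∷ 3 ∷ 1 ∷ []
  open Twist 4 4 xs ys refl refl (from-yes (inverse? 4 xs ys)) ≤-refl
  g₁ = twisted g
  e0 : g₁ 0 ≡ 3
  e0 = cong to g0
  e1 : g₁ 1 ≡ 2
  e1 = cong to g2
  e2 : g₁ 2 ≡ 1
  e2 = cong to (pred-step S {2} 2 (from-yes (2 <? 4)) g2 ≤-refl ≤-refl)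
  e3 : g₁ 3 ≡ 0
  e3 = cong to (pred-step S {0} 0 (s≤s z≤n) g0 (s≤s z≤n) ≤-refl)
  to1 : Path 2 g₁ 0 1
  to1 = done then (from-yes (0 <? 4) , flip-to 2 g₁ 0 1 e0 (zero , (λ ()) , refl))
  paths : ∀ {r} → r < 4 → Path 2 g₁ 0 r
  paths {0} _ = done
  paths {1} _ = to1
  paths {2} _ = done then (from-yes (0 <? 4) , flip-to 2 g₁ 0 2 e0 (suc zero , (λ ()) , refl))
  paths {3} _ = to1 then (from-yes (1 <? 4) , flip-to 2 g₁ 1 3 e1 (suc zero , (λ ()) , refl))
  paths {suc (suc (suc (suc _)))} (s≤s (s≤s (s≤s (s≤s ()))))
  r1 : Reach 2 g₁ 1
  r1 = step {p' = 0} (flip-to 2 g₁ 1 0 e1 (zero , (λ ()) , refl)) (from-yes (0 <? 4)) origin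
  all : ∀ p → p < 4 → Reach 2 g₁ p
  all 0 _ = origin
  all 1 _ = r1
  all 2 _ = step {p' = 0} (flip-to 2 g₁ 2 0 e2 (suc zero , (λ ()) , refl)) (from-yes (0 <? 4)) origin
  all 3 _ = step {p' = 1} (flip-to 2 g₁ 3 1 e3 (suc zero , (λ ()) , refl)) (from-yes (1 <? 4)) r1
  all (suc (suc (suc (suc _)))) (s≤s (s≤s (s≤s (s≤s ()))))

line-goal : ∀ {f : F 1} {g} → (∀ x → f x ≢ x) → Sorted 2 g → Labelled f g → g 0 ≡ 1 → Goal f
line-goal {f} {g} nofix S ℓ g0 = goal nofix ℓ all
    record { R = R ; zero∈ = here refl ; R≤4 = s≤s (s≤s z≤n) ; R< = R< ; R-path = path ; R-closed = λ {r} _ i _ → total (flip i (bits 1 r)) }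
  where
  R = 0 ∷ 1 ∷ []
  R< : ∀ {r} → r ∈ R → r < 2
  R< (here refl) = s≤s z≤n
  R< (there (here refl)) = ≤-refl
  total : ∀ x → ∃ λ r' → r' ∈ R × x ≡ bits 1 r'
  total (false ∷ []) = 0 , here refl , refl
  total (true ∷ []) = 1 , there (here refl) , refl
  path : ∀ {r} → r ∈ R → Path 1 g 0 r
  path (here refl) = done
  path (there (here refl)) = done then (s≤s z≤n , flip-to 1 g 0 1 g0 (zero , (λ ()) , refl))
  all : ∀ p → p < 2 → Reach 1 g p
  all 0 _ = origin
  all 1 _ = step {p' = 0} (flip-to 1 g 1 0 (pred-step S {0} 0 (s≤s z≤n) g0 (s≤s z≤n) ≤-refl) (zero , (λ ()) , refl)) (s≤s z≤n) origin
  all (suc (suc _)) (s≤s (s≤s ()))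

module Pairs {k : ℕ} {f : F (3 + k)} (nofix : ∀ x → f x ≢ x) (g : ℕ → ℕ) (S : Sorted (pow (3 + k)) g) (ℓ : Labelled f g)
  (up : ∀ p → p < pow (3 + k) → odd p ≡ false → g p ≡ suc p) where

  private
    n = 3 + k
    N = pow n
    t = top n
    8≤N = 8≤pow k
    7≤t : 7 ≤ t
    7≤t = ≤-pred (subst (8 ≤_) (pow≡1+top n) 8≤N)
    t<N : t < N
    t<N = ≤-reflexive (sym (pow≡1+top n))
    t-odd : odd t ≡ true
    t-odd = top-odd n (literal< {0} {1} (≤-trans (from-yes (1 ≤? 7)) 7≤t))

    down : ∀ p → p < N → odd p ≡ false → g (suc p) ≡ p
    down p p< e = pred-step S {p} p p< (up p p< e) ≤-refl ≤-refl

    ≤t : ∀ {p} → p < N → p ≤ t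
    ≤t {p} l = ≤-pred (subst (p <_) (pow≡1+top n) l)

    -- the pairs go to {0, 2}, {1, N - 1}, {3, 4}, {5, 6}, …
    to from : ℕ → ℕ
    to 0 = 0
    to 1 = 2
    to 2 = 1
    to 3 = t
    to (suc (suc (suc (suc j)))) = 3 + j
    from 0 = 0
    from 1 = 2
    from 2 = 1
    from (suc (suc (suc j))) with 3 + j ≟ t
    ... | yes _ = 3
    ... | no _ = 4 + j

    from-top : from t ≡ 3
    from-top = go t refl 7≤t
      where
      go : ∀ x → x ≡ t → 7 ≤ x → from x ≡ 3
      go (suc (suc (suc j))) e _ with 3 + j ≟ t
      ... | yes _ = refl
      ... | no ne = ⊥-elim (ne e)
      go 0 _ ()
      go 1 _ (s≤s ())
      go 2 _ (s≤s (s≤s ()))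

    from-mid : ∀ j → 3 + j ≢ t → from (3 + j) ≡ 4 + j
    from-mid j ne with 3 + j ≟ t
    ... | yes e = ⊥-elim (ne e)
    ... | no _ = refl

    ρ : Perm N
    ρ = record { to = to ; from = from ; to< = λ {p} → to< p ; from< = λ {p} → from< p ; to-from = λ {p} _ → tf p ; from-to = λ {p} → ft p }
      where
      to< : ∀ p → p < N → to p < N
      to< 0 l = l
      to< 1 _ = literal< 8≤N
      to< 2 _ = literal< 8≤N
      to< 3 _ = t<N
      to< (suc (suc (suc (suc j)))) l = <-trans ≤-refl l
      from< : ∀ p → p < N → from p < N
      from< 0 l = l
      from< 1 _ = literal< 8≤N
      from< 2 _ = literal< 8≤N
      from< (suc (suc (suc j))) l with 3 + j ≟ t
      ... | yes _ = literal< 8≤N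
      ... | no ne = subst (4 + j <_) (sym (pow≡1+top n)) (s≤s (≤∧≢⇒< (≤t l) ne))
      tf : ∀ p → to (from p) ≡ p
      tf 0 = refl
      tf 1 = refl
      tf 2 = refl
      tf (suc (suc (suc j))) with 3 + j ≟ t
      ... | yes e = sym e
      ... | no _ = refl
      ft : ∀ p → p < N → from (to p) ≡ p
      ft 0 _ = refl
      ft 1 _ = refl
      ft 2 _ = refl
      ft 3 _ = from-top
      ft (suc (suc (suc (suc j)))) l = from-mid j (λ e → <-irrefl refl (<-≤-trans (subst (_< 4 + j) e ≤-refl) (≤t l)))

    g' = conj ρ g

    e0 : g' 0 ≡ 2
    e0 = cong to (up 0 (literal< 8≤N) refl)
    e1 : g' 1 ≡ t
    e1 = cong to (up 2 (literal< 8≤N) refl)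
    e2 : g' 2 ≡ 0
    e2 = cong to (down 0 (literal< 8≤N) refl)
    et : g' t ≡ 1
    et = trans (cong (λ z → to (g z)) from-top) (cong to (down 2 (literal< 8≤N) refl))

    odd-mid : ∀ j → 3 + j < N → 3 + j ≢ t → odd (3 + j) ≡ true → g' (3 + j) ≡ 4 + j
    odd-mid j l ne o = trans (cong (λ z → to (g z)) (from-mid j ne)) (cong to (up (4 + j) (subst (4 + j <_) (sym (pow≡1+top n)) (s≤s (≤∧≢⇒< (≤t l) ne))) (cong not o)))

    even-mid : ∀ j → 3 + j < N → odd (3 + j) ≡ false → g' (3 + j) ≤ 3 + j
    even-mid j l e = ≤-trans (≤-reflexive (trans (cong (λ z → to (g z)) (from-mid j ne)) (cong to (down (3 + j) l e)))) (low j e)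
      where
      ne : 3 + j ≢ t
      ne eq = odd≢even {t} t-odd (trans (cong odd (sym eq)) e)
      low : ∀ j → odd (3 + j) ≡ false → to (3 + j) ≤ 3 + j
      low zero ()
      low (suc j) _ = n≤1+n _

    evens : ∀ x → x < N → odd x ≡ false → Reach n g' x
    evens = reach-even n g' 1 (λ { zero _ _ → origin ; (suc _) (s≤s ()) _ }) large
      where
      large : ∀ x → 1 ≤ x → x < N → odd x ≡ false → g' x ≤ x
      large 2 _ _ _ = ≤-trans (≤-reflexive e2) z≤n
      large (suc (suc (suc j))) _ l e = even-mid j l e

    3≢t : 3 ≢ t
    3≢t e = <⇒≱ (from-yes (3 <? 7)) (subst (7 ≤_) (sym e) 7≤t)

    -- The image of 1 has all bits one, so 1 may rise to 3; as 3 ↦ 4 is even, 3 drops to 2.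
    reach1 : Reach n g' 1
    reach1 = step {p' = 3} (flip-to n g' 1 3 e1 (suc zero , (λ eq → true≢false (trans (sym (top-bit n (suc zero))) eq)) , refl)) (literal< 8≤N)
      (step {p' = 2} (flip-to n g' 3 2 (odd-mid 0 (literal< 8≤N) 3≢t refl) (zero , (λ ()) , refl)) (literal< 8≤N) (evens 2 (literal< 8≤N) refl))

    all : ∀ p → p < N → Reach n g' p
    all = reach-all n g' 3 evens (λ { 1 _ _ _ → reach1 ; (suc (suc (suc _))) (s≤s (s≤s (s≤s ()))) _ _ }) large
      where
      large : ∀ x → 3 ≤ x → x < N → odd x ≡ true → g' x ≤ x ⊎ odd (g' x) ≡ false ⊎ Reach n g' x
      large x _ l o with x ≟ t
      large .t _ l o | yes refl = inj₁ (≤-trans (≤-reflexive et) (≤-trans (from-yes (1 ≤? 7)) 7≤t))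
      large (suc (suc (suc j))) _ l o | no ne = inj₂ (inj₁ (trans (cong odd (odd-mid j l ne o)) (cong not o)))
      large 1 (s≤s ()) l o | no ne

  -- When all blocks have length two, the last one cannot be long. Pairing N - 1 with 1 instead of
  -- its neighbour makes N - 1 descend, while 1 can still rise and escape.
  pairs-goal : Goal f
  pairs-goal = goal nofix (relabel ρ ℓ) all (pair-core e0 e2)

-- Choice of the numbering

even≡double : ∀ p → odd p ≡ false → p ≡ double ⌊ p /2⌋
even≡double p e = trans (sym (join-half p)) (cong (λ b → join b ⌊ p /2⌋) e)

double<⁻ : ∀ {i j} → double i < double j → i < j
double<⁻ {i} {j} l with i <? j
... | yes p = p
... | no np = ⊥-elim (<⇒≱ l (double-mono-≤ (≮⇒≥ np)))

module _ {n : ℕ} {f : F n} {g : ℕ → ℕ} (S : Sorted (pow n) g) (ℓ : Labelled f g) where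
  open Labelled ℓ
  open Arrange f using (iter; iter-+)

  f-unl : ∀ {p} → p < pow n → f (unl p) ≡ unl (g p)
  f-unl p< = trans (sym (unl-lab _)) (cong unl (trans (commutes _) (cong g (lab-unl p<))))

  unl-inj : ∀ {p q} → p < pow n → q < pow n → unl p ≡ unl q → p ≡ q
  unl-inj p< q< e = trans (sym (lab-unl p<)) (trans (cong lab e) (lab-unl q<))

  no-two-cycles : (∀ x → f (f x) ≢ x) → ∀ p → p < pow n → g (g p) ≢ p
  no-two-cycles no2 p p< e = no2 (unl p) (trans (cong f (f-unl p<)) (trans (f-unl (Sorted.bound S p<)) (cong unl e)))

  -- One step leads from p up to g p, and g p - p steps of one lead back down.
  start-returns : ∀ {p} → p < pow n → p < g p → iter (suc (g p ∸ p)) (unl p) ≡ unl p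
  start-returns {p} p< st = trans (cong (λ z → iter z (unl p)) (sym (trans (+-suc d 0) (cong suc (+-identityʳ d)))))
      (trans (iter-+ d 1 (unl p)) (trans (cong (iter d) (f-unl p<)) (trans (back d ≤-refl) (cong unl (m∸[m∸n]≡n (<⇒≤ st))))))
    where
    q = g p
    d = q ∸ p
    back : ∀ j → j ≤ d → iter j (unl q) ≡ unl (q ∸ j)
    back zero _ = refl
    back (suc j) j<d = trans (cong f (back j (<⇒≤ j<d))) (trans (f-unl (≤-<-trans (m∸n≤m q j) (Sorted.bound S p<))) (cong unl eq))
      where
      p<r : p < q ∸ j
      p<r = subst (_< q ∸ j) (m∸[m∸n]≡n (<⇒≤ st)) (∸-monoʳ-< j<d (m∸n≤m q p))
      eq : g (q ∸ j) ≡ q ∸ suc j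
      eq = suc-injective (trans (Sorted.contiguous S p (q ∸ j) p< p<r (m∸n≤m q j)) (+-∸-assoc 1 (<-≤-trans j<d (m∸n≤m q p))))

module _ {n : ℕ} (f : F n) where
  open Arrange f
  open State
  open Period
  private
    N = pow n

  -- A two-cycle at the last two positions lies among the pairs placed in the first phase.
  last-pair : ∀ {k} {s : State k} (pr : Paired s) (so : Sorting (Paired.s' pr)) {t : ℕ} →
    pow n ≡ suc (suc t) → Sorting.g so t ≡ suc t → t < Paired.k' pr
  last-pair pr so {t} N≡ gt = placed (exhausted (unl t) ff ne)
    where
    open Paired pr
    open Sorting so
    open Labelled labelled
    t< : t < pow n
    t< = subst (t <_) (sym N≡) (<-trans ≤-refl ≤-refl)
    t+1< : suc t < pow n
    t+1< = subst (suc t <_) (sym N≡) ≤-refl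
    gt+1 : g (suc t) ≡ t
    gt+1 = pred-step sorted {t} t t< gt ≤-refl ≤-refl
    ff : f (f (unl t)) ≡ unl t
    ff = trans (cong f (trans (f-unl sorted labelled t<) (cong unl gt))) (trans (f-unl sorted labelled t+1<) (cong unl gt+1))
    ne : f (unl t) ≢ unl t
    ne e = <-irrefl (unl-inj sorted labelled t< t+1< (trans (sym e) (trans (f-unl sorted labelled t<) (cong unl gt)))) ≤-refl
    placed : Placed s' (unl t) → t < k'
    placed (p , p< , e) = subst (_< k') (unl-inj sorted labelled (<-≤-trans p< (state≤ s')) t< (trans (unl≡ p<) e)) p<

  module _ (x : Conf n) (fx : f x ≡ x) (t : ℕ) (N≡ : pow n ≡ suc (suc t)) (t-even : odd t ≡ false) where

    -- Behind the fixed point at 0 the pairs occupy (1 , 2), (3 , 4) and so on. The even position t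
    -- = N - 2 would be the second of its pair, so it cannot start a last block of length two.
    fixed-case : ∃ λ (h : F n) → (h ∼ f) × NumAttractors h (fp f)
    fixed-case = FromOrigin.fixed-goal g sorted labelled long g0
      where
      P : Period x 1
      P = record { positive = s≤s z≤n ; returns = fx ; minimal = λ { (suc _) _ (s≤s ()) } }
      new : ¬ Placed empty x
      new (_ , () , _)
      s₁ = add-cycle empty P new
      pr = pair-up N s₁ (m≤n+m N 1)
      open Paired pr
      open Sorting (sort s')
      0<k' : 0 < k'
      0<k' = subst (0 <_) (sym k'≡) (s≤s z≤n)
      g0 : g 0 ≡ 0
      g0 = agrees 0<k' 0<k' (trans (cong f (proj₂ extends (s≤s z≤n))) (trans (add-cycle-start empty P new) (sym (proj₂ extends (s≤s z≤n)))))
      top≡ : top n ≡ suc t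
      top≡ = suc-injective (trans (sym (pow≡1+top n)) N≡)
      contra : ∀ t' → t ≡ t' → g t ≡ suc t → ⊥
      contra zero refl gt = 0≢1+n (trans (sym g0) gt)
      contra (suc zero) refl gt = true≢false t-even
      contra (suc (suc q)) refl gt = <-irrefl (trans (sym gq+2) gt) (<-trans ≤-refl ≤-refl)
        where
        t<k' = last-pair pr (sort s') N≡ gt
        i = ⌊ q /2⌋
        q≡ : q ≡ double i
        q≡ = even≡double q (trans (sym (not-not (odd q))) t-even)
        i<j : i < j
        i<j = double<⁻ (subst (_< double j) q≡ (<-trans ≤-refl (≤-pred (subst (suc (suc q) <_) k'≡ t<k'))))
        gq : g (suc q) ≡ suc (suc q)
        gq = agrees (<-trans ≤-refl t<k') t<k' (link (suc q) i i<j (cong suc q≡))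
        gq+2 : g (suc (suc q)) ≡ suc q
        gq+2 = pred-step sorted {suc q} (suc q) (subst (suc q <_) (sym N≡) (s≤s (≤-trans (n≤1+n _) (n≤1+n _)))) gq ≤-refl ≤-refl
      long : g (pred (top n)) ≢ top n
      long e = contra t refl (trans (cong (λ z → g (pred z)) (sym top≡)) (trans e top≡))

  module _ (nofix : ∀ x → f x ≢ x) (x : Conf n) (ffx : f (f x) ≡ x) (t : ℕ) (N≡ : pow n ≡ suc (suc t)) (t-even : odd t ≡ false) where

    -- The pairs occupy (0 , 1), (2 , 3) and so on. A last block of length two belongs to them, and
    -- then they fill all positions.
    two-cycle-case : ∃ λ g → Sorted N g × Labelled f g × g 0 ≡ 1 ×
      ((g (pred (top n)) ≢ top n) ⊎ (∀ p → p < N → odd p ≡ false → g p ≡ suc p))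
    two-cycle-case = g , sorted , labelled , first (exhausted x ffx (nofix x)) , last (g t ≟ suc t)
      where
      pr = pair-up N empty ≤-refl
      open Paired pr
      open Sorting (sort s')
      linked : ∀ i → i < j → g (double i) ≡ suc (double i)
      linked i i<j = agrees (<-trans ≤-refl l) l (link (double i) i i<j refl)
        where
        l : suc (double i) < k'
        l = subst (suc (double i) <_) (sym k'≡) (double-mono-≤ i<j)
      first : Placed s' x → g 0 ≡ 1
      first (p , p<k , _) = linked 0 (double<⁻ (≤-<-trans z≤n (subst (p <_) k'≡ p<k)))
      top≡ : top n ≡ suc t
      top≡ = suc-injective (trans (sym (pow≡1+top n)) N≡)
      last : Dec (g t ≡ suc t) → (g (pred (top n)) ≢ top n) ⊎ (∀ p → p < N → odd p ≡ false → g p ≡ suc p)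
      last (no ne) = inj₁ (λ e → ne (trans (cong (λ z → g (pred z)) (sym top≡)) (trans e top≡)))
      last (yes gt) = inj₂ λ p p< e → trans (cong g (even≡double p e)) (trans (linked ⌊ p /2⌋ (double<⁻ (subst (_< double j) (even≡double p e) (<-≤-trans p< N≤)))) (cong suc (sym (even≡double p e))))
        where
        t<k' = last-pair pr (sort s') N≡ gt
        N≤ : N ≤ double j
        N≤ = subst (_≤ double j) (sym (trans N≡ (cong (λ z → suc (suc z)) (even≡double t t-even))))
               (double-mono-≤ (double<⁻ {⌊ t /2⌋} {j} (subst (_< double j) (even≡double t t-even) (subst (t <_) k'≡ t<k'))))

  data Shape (L : ℕ) : Set where
    two : ∀ {x y M} (P : Period x (suc L)) (new : ¬ Placed empty x) → Period y (suc M) → ¬ Placed (add-cycle empty P new) y → Shape L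
    star : ∀ {x} (P : Period x (suc L)) (new : ¬ Placed empty x) b → ¬ Placed (add-cycle empty P new) b → f b ≡ at (add-cycle empty P new) 1 →
      (∀ y i → iter (suc i) y ≡ y → Placed (add-cycle empty P new) y) → Shape L
    whole : ∀ {x} → Period x (suc L) → N ≡ suc L → Shape L

  period≤N : ∀ {x L} → Period x (suc L) → suc L ≤ N
  period≤N P = state≤ (add-cycle empty P (λ { (_ , () , _) }))

  iter-comm : ∀ i j x → iter i (iter j x) ≡ iter j (iter i x)
  iter-comm i j x = trans (sym (iter-+ i j x)) (trans (cong (λ z → iter z x) (+-comm i j)) (iter-+ j i x))

  module _ (L : ℕ) (short : ∀ z i → 0 < i → i < suc (suc L) → iter i z ≢ z) where

    -- If no outside vertex is mapped onto the cycle, the outside is closed under f, so it is empty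
    -- or contains a second cycle. Otherwise an entering vertex b is fixed first, and then a second
    -- cycle is looked for. The assumption `short` makes the period exactly L + 2.
    analyse : ∀ x → iter (suc (suc L)) x ≡ x → Shape (suc L)
    analyse x ret = by-tree (any-conf? (λ b → ¬? (placed? s b) ×-dec placed? s (f b)))
      where
      mk : ∀ z → iter (suc (suc L)) z ≡ z → Period z (suc (suc L))
      mk z e = record { positive = s≤s z≤n ; returns = e ; minimal = short z }
      P = mk x ret
      new : ∀ {z} → ¬ Placed empty z
      new (_ , () , _)
      s = add-cycle empty P new
      on-cycle : ∀ z → Placed s z → iter (suc (suc L)) z ≡ z
      on-cycle z (p , p< , e) = subst (λ w → iter (suc (suc L)) w ≡ w) (trans (sym (add-cycle-at empty P new p)) e)
        (trans (iter-comm (suc (suc L)) (suc L ∸ p) x) (cong (iter (suc L ∸ p)) ret))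
      by-tree : Dec (∃ λ b → ¬ Placed s b × Placed s (f b)) → Shape (suc L)
      by-tree (yes (b , nb , pl)) = other (any-conf? (λ y → ¬? (placed? s' y) ×-dec anyUpTo? (λ i → iter (suc i) y ≟C y) N))
        where
        -- the cycle is numbered backwards from x', so that f b gets number 1
        c = f b
        x' = iter 2 c
        ret' : iter (suc (suc L)) x' ≡ x'
        ret' = trans (iter-comm (suc (suc L)) 2 c) (cong (iter 2) (on-cycle c pl))
        P' = mk x' ret'
        s' = add-cycle empty P' new
        nb' : ¬ Placed s' b
        nb' (p , p< , e) = nb (subst (Placed s) (trans (sym (add-cycle-at empty P' new p)) e) (placed-iter s (suc L ∸ p) (placed-iter s 2 pl)))
        c≡ : c ≡ at s' 1
        c≡ = sym (trans (add-cycle-at empty P' new 1) (trans (sym (iter-+ L 2 c)) (trans (cong (λ z → iter z c) (+-comm L 2)) (on-cycle c pl))))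
        other : Dec (∃ λ y → ¬ Placed s' y × ∃ λ i → i < N × iter (suc i) y ≡ y) → Shape (suc L)
        other (yes (y , ny , i , _ , e)) with period y (suc i) (s≤s z≤n) e
        ... | zero , Q , _ = ⊥-elim (n≮0 (positive Q))
        ... | suc M , Q , _ = two P' new Q ny
        other (no none) = star P' new b nb' c≡ all-placed
          where
          all-placed : ∀ y i → iter (suc i) y ≡ y → Placed s' y
          all-placed y i e with placed? s' y
          ... | yes p = p
          ... | no ny with period y (suc i) (s≤s z≤n) e
          ...   | zero , Q , _ = ⊥-elim (n≮0 (positive Q))
          ...   | suc M , Q , _ = ⊥-elim (none (y , ny , M , period≤N Q , returns Q))
      by-tree (no none) with full? s
      ... | inj₁ full = whole P (sym (full⇒≡ s full))
      ... | inj₂ (u , nu) with grow s u nu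
      ...   | cycle Q ny = two P new Q ny
      ...   | tree b nb fb = ⊥-elim (none (b , nb , fb))

  module _ {L M : ℕ} {x y : Conf n} (P : Period x (suc L)) (new : ¬ Placed empty x) (Q : Period y (suc M)) (new' : ¬ Placed (add-cycle empty P new) y) where
    private
      s₁ = add-cycle empty P new
      s₂ = add-cycle s₁ Q new'
      ext = add-cycle-⊑ s₁ Q new'

    two-sorted : suc L + suc M ≤ N × ∃ λ g → Sorted N g × Labelled f g × g 0 ≡ L × g (suc L) ≡ suc L + M
    two-sorted = state≤ s₂ , g , sorted , labelled ,
      agrees (s≤s z≤n) (<-≤-trans ≤-refl (proj₁ ext)) (trans (cong f (proj₂ ext (s≤s z≤n))) (trans (add-cycle-start empty P new) (sym (proj₂ ext ≤-refl)))) ,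
      agrees (subst (_< suc L + suc M) (+-identityʳ (suc L)) (+-monoʳ-< (suc L) (s≤s z≤n))) (+-monoʳ-< (suc L) ≤-refl)
        (subst (λ z → f (at s₂ z) ≡ at s₂ (suc L + M)) (+-identityʳ (suc L)) (add-cycle-start s₁ Q new'))
      where open Sorting (sort s₂)

  module _ (nofix : ∀ x → f x ≢ x) {L : ℕ} {x : Conf n} (P : Period x (suc (suc L))) (new : ¬ Placed empty x) (b : Conf n) (nb : ¬ Placed (add-cycle empty P new) b)
    (fb : f b ≡ at (add-cycle empty P new) 1) (cyc : ∀ y i → iter (suc i) y ≡ y → Placed (add-cycle empty P new) y) where
    private
      s₁ = add-cycle empty P new
      pl : Placed s₁ (f b)
      pl = 1 , s≤s (s≤s z≤n) , sym fb
      s₂ = add-tree s₁ b nb pl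
      ext = add-tree-⊑ s₁ b nb pl

    star-sorted : suc (suc (suc L)) ≤ N × ∃ λ g → Sorted N g × Labelled f g × g 0 ≡ suc L × g (suc (suc L)) ≡ 1 × (∀ p → suc (suc (suc L)) ≤ p → p < N → g p < p)
    star-sorted = subst (_≤ N) (+-comm (suc (suc L)) 1) (state≤ s₂) , g , sorted , labelled ,
      agrees (s≤s z≤n) (<-≤-trans ≤-refl (proj₁ ext)) (trans (cong f (proj₂ ext (s≤s z≤n))) (trans (add-cycle-start empty P new) (sym (proj₂ ext ≤-refl)))) ,
      agrees (subst (suc (suc L) <_) (+-comm 1 (suc (suc L))) ≤-refl) (<-≤-trans (s≤s (s≤s z≤n)) (proj₁ ext))
        (trans (cong f (subst (λ z → at s₂ z ≡ b) (+-identityʳ (suc (suc L))) (add-tree-at s₁ b nb pl))) (trans fb (sym (proj₂ ext (s≤s (s≤s z≤n)))))) ,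
      trees
      where
      open Sorting (sort s₂)
      open Labelled labelled
      -- By `start-returns`, p < g p would put the vertex on a cycle; but all cycle vertices
      -- received smaller numbers, and nothing is fixed.
      trees : ∀ p → suc (suc (suc L)) ≤ p → p < N → g p < p
      trees p le p< = ≰⇒> λ p≤ → bad (m≤n⇒m<n∨m≡n p≤)
        where
        bad : p < g p ⊎ p ≡ g p → ⊥
        bad (inj₂ e) = nofix (unl p) (trans (f-unl sorted labelled p<) (cong unl (sym e)))
        bad (inj₁ st) with cyc (unl p) (g p ∸ p) (start-returns sorted labelled p< st)
        ... | q , q< , e = <⇒≱ q< (≤-trans (≤-trans (n≤1+n _) le) (≤-reflexive (sym q≡p)))
          where
          q≡p : q ≡ p
          q≡p = unl-inj sorted labelled (<-≤-trans q< (state≤ s₁)) p< (trans (unl≡ (<-≤-trans q< (proj₁ ext))) (trans (proj₂ ext q<) e))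

  one-sorted : ∀ {L x} → Period x (suc L) → suc L ≤ N × ∃ λ g → Sorted N g × Labelled f g × g 0 ≡ L
  one-sorted P = state≤ s , g , sorted , labelled , agrees (s≤s z≤n) ≤-refl (add-cycle-start empty P new)
    where
    new : ∀ {z} → ¬ Placed empty z
    new (_ , () , _)
    s = add-cycle empty P new
    open Sorting (sort s)

-- Case distinction by cycle lengths

dim≥2 : ∀ {n} (Q : ℕ → Set) → 3 ≤ pow n → (∀ k → Q (2 + k)) → Q n
dim≥2 {0} Q (s≤s ()) q
dim≥2 {1} Q (s≤s (s≤s ())) q
dim≥2 {suc (suc k)} Q _ q = q k

dim≥3 : ∀ {n} (Q : ℕ → Set) → 5 ≤ pow n → (∀ k → Q (3 + k)) → Q n
dim≥3 {0} Q (s≤s ()) q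
dim≥3 {1} Q (s≤s (s≤s ())) q
dim≥3 {2} Q (s≤s (s≤s (s≤s (s≤s ())))) q
dim≥3 {suc (suc (suc k))} Q _ q = q k

module _ {n : ℕ} {f : F n} {g : ℕ → ℕ} (nofix : ∀ x → f x ≢ x) (no2 : ∀ x → f (f x) ≢ x) (S : Sorted (pow n) g) (ℓ : Labelled f g) where

  private
    in-dim≥3 : (C : (ℕ → ℕ) → Set) → 5 ≤ pow n →
      (∀ {k} {f : F (3 + k)} → (∀ x → f x ≢ x) → ∀ g → Sorted (pow (3 + k)) g → Labelled f g → (∀ p → p < pow (3 + k) → g (g p) ≢ p) → C g → Goal f) →
      C g → Goal f
    in-dim≥3 C 5≤ lemma c =
      dim≥3 (λ n → (f : F n) → (∀ x → f x ≢ x) → (∀ x → f (f x) ≢ x) → Sorted (pow n) g → Labelled f g → Goal f) 5≤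
        (λ k f nofix no2 S ℓ → lemma nofix g S ℓ (no-two-cycles S ℓ no2) c) f nofix no2 S ℓ

    in-dim≥2 : (C : ℕ → (ℕ → ℕ) → Set) → 3 ≤ pow n →
      (∀ {k} {f : F (2 + k)} → (∀ x → f x ≢ x) → ∀ g → Sorted (pow (2 + k)) g → Labelled f g → C (pow (2 + k)) g → Goal f) →
      C (pow n) g → Goal f
    in-dim≥2 C 3≤ lemma c =
      dim≥2 (λ n → (f : F n) → (∀ x → f x ≢ x) → Sorted (pow n) g → Labelled f g → C (pow n) g → Goal f) 3≤
        (λ k f nofix S ℓ → lemma nofix g S ℓ) f nofix S ℓ c

  long-cycle : 5 ≤ pow n → 5 ≤ g 0 → Goal f
  long-cycle 5≤N = in-dim≥3 (λ g → 5 ≤ g 0) 5≤N PathCases.long-cycle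

  triangle-and-cycle : 5 ≤ pow n → g 0 ≡ 2 → 5 ≤ g 3 → Goal f
  triangle-and-cycle 5≤N e e' = in-dim≥3 (λ g → g 0 ≡ 2 × 5 ≤ g 3) 5≤N (λ nf g S ℓ no2 (x , y) → PathCases.triangle-and-cycle nf g S ℓ no2 x y) (e , e')

  square-and-cycle : 5 ≤ pow n → g 0 ≡ 3 → g 4 ≡ 7 ⊎ g 4 ≡ 8 → Goal f
  square-and-cycle 5≤N e e' = in-dim≥3 (λ g → g 0 ≡ 3 × (g 4 ≡ 7 ⊎ g 4 ≡ 8)) 5≤N (λ nf g S ℓ no2 (x , y) → PathCases.square-and-cycle nf g S ℓ no2 x y) (e , e')

  two-pentagons : 9 ≤ pow n → g 0 ≡ 4 → g 5 ≡ 9 → Goal f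
  two-pentagons 9≤N e e' = dim≥3 (λ n → (f : F n) → (∀ x → f x ≢ x) → (∀ x → f (f x) ≢ x) → Sorted (pow n) g → Labelled f g → 9 ≤ pow n → Goal f) (≤-trans (from-yes (5 ≤? 9)) 9≤N)
        (λ k f nofix no2 S ℓ 9≤N → PathCases.two-pentagons nofix g S ℓ (no-two-cycles S ℓ no2) 9≤N e e') f nofix no2 S ℓ 9≤N

  triangle-star : 3 ≤ pow n → g 0 ≡ 2 → g 3 ≡ 1 → (∀ x → 4 ≤ x → x < pow n → g x < x) → Goal f
  triangle-star 3≤N e e' d = in-dim≥2 (λ N g → g 0 ≡ 2 × g 3 ≡ 1 × (∀ x → 4 ≤ x → x < N → g x < x)) 3≤N (λ nf g S ℓ (x , y , z) → StarCases.triangle-star nf g S ℓ x y z) (e , e' , d)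

  square-star : 5 ≤ pow n → g 0 ≡ 3 → g 4 ≡ 1 → (∀ x → 5 ≤ x → x < pow n → g x < x) → Goal f
  square-star 5≤N e e' d = in-dim≥2 (λ N g → 5 ≤ N × g 0 ≡ 3 × g 4 ≡ 1 × (∀ x → 5 ≤ x → x < N → g x < x)) (≤-trans (from-yes (3 ≤? 5)) 5≤N) (λ nf g S ℓ (w , x , y , z) → StarCases.square-star nf g S ℓ w x y z) (5≤N , e , e' , d)

  pentagon-star : 6 ≤ pow n → g 0 ≡ 4 → g 5 ≡ 1 → (∀ x → 6 ≤ x → x < pow n → g x < x) → Goal f
  pentagon-star 6≤N e e' d = in-dim≥2 (λ N g → 6 ≤ N × g 0 ≡ 4 × g 5 ≡ 1 × (∀ x → 6 ≤ x → x < N → g x < x)) (≤-trans (from-yes (3 ≤? 6)) 6≤N) (λ nf g S ℓ (w , x , y , z) → StarCases.pentagon-star nf g S ℓ w x y z) (6≤N , e , e' , d)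

pow≢odd : ∀ n L → odd L ≡ true → 3 ≤ L → pow n ≢ L
pow≢odd zero L o 3≤ e = <⇒≱ (from-yes (1 <? 3)) (subst (3 ≤_) (sym e) 3≤)
pow≢odd (suc n) L o 3≤ e = odd≢even {L} o (trans (cong odd (sym e)) (odd-double (pow n)))

whole-square : ∀ n {f : F n} {g} → pow n ≡ 4 → (∀ x → f x ≢ x) → Sorted (pow n) g → Labelled f g → g 0 ≡ 3 → Goal f
whole-square 0 () _ _ _ _
whole-square 1 () _ _ _ _
whole-square 2 _ nf S ℓ e = square-goal nf S ℓ e
whole-square (suc (suc (suc k))) e _ _ _ _ = ⊥-elim (<⇒≱ (from-yes (4 <? 8)) (subst (8 ≤_) e (8≤pow k)))

two-cycles : ∀ n {f : F (suc n)} → (∀ x → f x ≢ x) → ∃ (λ x → f (f x) ≡ x) → Goal f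
two-cycles n {f} nofix (x , ffx) = dispatch n (two-cycle-case f nofix x ffx (double (top n)) (cong double (pow≡1+top n)) (odd-double (top n))) nofix
  where
  dispatch : ∀ n {f : F (suc n)} → (∃ λ g → Sorted (pow (suc n)) g × Labelled f g × g 0 ≡ 1 ×
      ((g (pred (top (suc n))) ≢ top (suc n)) ⊎ (∀ p → p < pow (suc n) → odd p ≡ false → g p ≡ suc p))) → (∀ x → f x ≢ x) → Goal f
  dispatch zero (g , S , ℓ , g0 , _) nf = line-goal nf S ℓ g0
  dispatch (suc k) (g , S , ℓ , g0 , inj₁ long) nf = FromOrigin.two-cycle-goal g S ℓ long nf g0 (k , refl)
  dispatch (suc zero) (g , S , ℓ , g0 , inj₂ up) nf = two-pairs-goal nf S ℓ g0 (up 2 (from-yes (2 <? 4)) refl)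
  dispatch (suc (suc k)) (g , S , ℓ , g0 , inj₂ up) nf = Pairs.pairs-goal nf g S ℓ up

module _ {n : ℕ} (f : F n) (nofix : ∀ x → f x ≢ x) (no2 : ∀ x → f (f x) ≢ x) where
  open Arrange f
  open Period

  short-cycles : ℕ → Set
  short-cycles L = ∀ z i → 0 < i → i < L → iter i z ≢ z

  private
    avoid-suc : ∀ {L} → short-cycles L → (∀ z → iter L z ≢ z) → short-cycles (suc L)
    avoid-suc sh noL z i 0<i (s≤s i≤) e with m≤n⇒m<n∨m≡n i≤
    ... | inj₁ l = sh z i 0<i l e
    ... | inj₂ refl = noL z e

    avoid3 : short-cycles 3
    avoid3 = avoid-suc {2} (avoid-suc {1} (λ { _ (suc _) _ (s≤s ()) _ }) nofix) no2

    period≥ : ∀ {L x M} → short-cycles L → Period x M → L ≤ M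
    period≥ {L} {x} {M} sh Q = ≮⇒≥ λ l → sh x M (positive Q) l (returns Q)

    period≤ : ∀ {x M} L → Period x M → iter (suc L) x ≡ x → M ≤ suc L
    period≤ L Q e = ≮⇒≥ λ l → minimal Q (suc L) (s≤s z≤n) l e

  triangles : ∃ (λ x → iter 3 x ≡ x) → Goal f
  triangles (x , e) with analyse f 1 avoid3 x e
  ... | whole P N≡3 = ⊥-elim (pow≢odd n 3 refl ≤-refl N≡3)
  ... | two {M = M} P new Q ny =
        let N≥ , g , S , ℓ , g0 , g3 = two-sorted f P new Q ny
            2≤M = ≤-pred (period≥ avoid3 Q)
        in triangle-and-cycle nofix no2 S ℓ (≤-trans (+-monoʳ-≤ 3 (≤-trans 2≤M (n≤1+n M))) N≥) g0 (subst (5 ≤_) (sym g3) (+-monoʳ-≤ 3 2≤M))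
  ... | star P new b nb fb cyc =
        let N≥ , g , S , ℓ , g0 , g3 , trees = star-sorted f nofix P new b nb fb cyc
        in triangle-star nofix no2 S ℓ (≤-trans (n≤1+n 3) N≥) g0 g3 trees

  module _ (no3 : ∀ x → iter 3 x ≢ x) where

    private
      avoid4 : short-cycles 4
      avoid4 = avoid-suc {3} avoid3 no3

    -- A periodic vertex that does not return after one to five steps has period at least six.
    long-cycles : ∃ (λ x → (iter 4 x ≢ x × iter 5 x ≢ x) × ∃ λ i → i < pow n × iter (suc i) x ≡ x) → Goal f
    long-cycles (x , (ne4 , ne5) , i , _ , e) with period x (suc i) (s≤s z≤n) e
    ... | M , P , _ = go M P 6≤M
      where
      6≤M : 6 ≤ M
      6≤M with m≤n⇒m<n∨m≡n (period≥ avoid4 P)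
      ... | inj₂ refl = ⊥-elim (ne4 (returns P))
      ... | inj₁ l with m≤n⇒m<n∨m≡n l
      ...   | inj₂ refl = ⊥-elim (ne5 (returns P))
      ...   | inj₁ l' = l'
      go : ∀ M → Period x M → 6 ≤ M → Goal f
      go (suc L) P (s≤s 5≤L) =
        let N≥ , g , S , ℓ , g0 = one-sorted f P
        in long-cycle nofix no2 S ℓ (≤-trans (≤-trans 5≤L (n≤1+n L)) N≥) (subst (5 ≤_) (sym g0) 5≤L)

    module _ (short : ∀ x i → i < pow n → iter (suc i) x ≡ x → iter 4 x ≡ x ⊎ iter 5 x ≡ x) where

      private
        cycle-4-5 : ∀ {y M} → Period y (suc M) → iter 4 y ≡ y ⊎ iter 5 y ≡ y
        cycle-4-5 {y} {M} Q = short y M (period≤N f Q) (returns Q)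

      -- Only lengths four and five are left, so a second cycle beginning at 4 ends at 7 or 8.
      squares : ∃ (λ x → iter 4 x ≡ x) → Goal f
      squares (x , e) with analyse f 2 avoid4 x e
      ... | whole P N≡4 = let _ , g , S , ℓ , g0 = one-sorted f P in whole-square n N≡4 nofix S ℓ g0
      ... | star P new b nb fb cyc =
            let N≥ , g , S , ℓ , g0 , g4 , trees = star-sorted f nofix P new b nb fb cyc
            in square-star nofix no2 S ℓ N≥ g0 g4 trees
      ... | two {M = M} P new Q ny =
            let N≥ , g , S , ℓ , g0 , g4 = two-sorted f P new Q ny
            in square-and-cycle nofix no2 S ℓ (≤-trans (+-monoʳ-≤ 4 (s≤s z≤n)) N≥) g0 (value g4)
        where
        M≤4 : M ≤ 4
        M≤4 with cycle-4-5 Q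
        ... | inj₁ e4 = ≤-trans (≤-pred (period≤ 3 Q e4)) (n≤1+n 3)
        ... | inj₂ e5 = ≤-pred (period≤ 4 Q e5)
        value : ∀ {x} → x ≡ 4 + M → x ≡ 7 ⊎ x ≡ 8
        value e with m≤n⇒m<n∨m≡n (≤-pred (period≥ avoid4 Q))
        ... | inj₂ refl = inj₁ e
        ... | inj₁ l with ≤-antisym l M≤4
        ...   | refl = inj₂ e

      -- All cycles now have length five. Growing the empty numbering must produce one, since a tree
      -- vertex needs a placed image.
      pentagons : (∀ x → iter 4 x ≢ x) → Goal f
      pentagons no4 with grow empty (bits n 0) (λ { (_ , () , _) })
      ... | tree _ _ (_ , () , _)
      ... | cycle {x = x} Q _ with cycle-4-5 Q
      ...   | inj₁ e4 = ⊥-elim (no4 x e4)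
      ...   | inj₂ e5 with analyse f 3 (avoid-suc {4} avoid4 no4) x e5
      ...     | whole P N≡5 = ⊥-elim (pow≢odd n 5 refl (from-yes (3 ≤? 5)) N≡5)
      ...     | star P new b nb fb cyc =
                let N≥ , g , S , ℓ , g0 , g5 , trees = star-sorted f nofix P new b nb fb cyc
                in pentagon-star nofix no2 S ℓ N≥ g0 g5 trees
      ...     | two {y = y} {M} P new Q' ny =
                let N≥ , g , S , ℓ , g0 , g5 = two-sorted f P new Q' ny
                in two-pentagons nofix no2 S ℓ (≤-trans (+-monoʳ-≤ 5 (≤-trans (≤-reflexive (sym M≡4)) (n≤1+n M))) N≥) g0 (trans g5 (cong (5 +_) M≡4))
        where
        M≡4 : M ≡ 4
        M≡4 with cycle-4-5 Q'
        ... | inj₁ e4 = ⊥-elim (no4 y e4)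
        ... | inj₂ e5' = ≤-antisym (≤-pred (period≤ 4 Q' e5')) (≤-pred (period≥ (avoid-suc {4} avoid4 no4) Q'))

  -- Lengths of six or more are settled before four and five, so that in the latter cases the second
  -- cycle has bounded length and fits a finite layout.
  no-short-cycles : Goal f
  no-short-cycles with any-conf? (λ x → iter 3 x ≟C x)
  ... | yes t = triangles t
  ... | no no3 with any-conf? (λ x → (¬? (iter 4 x ≟C x) ×-dec ¬? (iter 5 x ≟C x)) ×-dec anyUpTo? (λ i → iter (suc i) x ≟C x) (pow n))
  ...   | yes l = long-cycles (λ x e → no3 (x , e)) l
  ...   | no nl = by-squares (any-conf? (λ x → iter 4 x ≟C x))
    where
    short : ∀ x i → i < pow n → iter (suc i) x ≡ x → iter 4 x ≡ x ⊎ iter 5 x ≡ x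
    short x i i< e with iter 4 x ≟C x | iter 5 x ≟C x
    ... | yes e4 | _ = inj₁ e4
    ... | no _ | yes e5 = inj₂ e5
    ... | no ne4 | no ne5 = ⊥-elim (nl (x , (ne4 , ne5) , i , i< , e))
    by-squares : Dec (∃ λ x → iter 4 x ≡ x) → Goal f
    by-squares (yes sq) = squares (λ x e → no3 (x , e)) short sq
    by-squares (no no4) = pentagons (λ x e → no3 (x , e)) short (λ x e → no4 (x , e))

fixed-point-exists : ∀ {n} (f : F n) → 1 ≤ fp f → ∃ λ x → f x ≡ x
fixed-point-exists {n} f 1≤ = first (filter fix? (allConfs n)) (subst (1 ≤_) (count≡length fix? (allConfs n)) 1≤) (λ m → proj₂ (∈-filter⁻ fix? {xs = allConfs n} m))
  where
  fix? : ∀ x → Dec (f x ≡ x)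
  fix? x = f x ≟C x
  first : ∀ xs → 1 ≤ length xs → (∀ {x} → x ∈ xs → f x ≡ x) → ∃ λ x → f x ≡ x
  first (x ∷ _) _ h = x , h (here refl)

no-fixed-point : ∀ {n} (f : F n) → fp f ≡ 0 → ∀ x → f x ≢ x
no-fixed-point {n} f e x fx = <-irrefl (sym (trans (sym (count≡length fix? (allConfs n))) e)) (∈-length (∈-filter⁺ fix? (allConfs-complete x) fx))
  where
  fix? : ∀ x → Dec (f x ≡ x)
  fix? x = f x ≟C x

theorem3 : (n : ℕ) → 1 ≤ n → (f : F n) →
    (1 ≤ fp f → ∃ λ (h : F n) → (h ∼ f) × NumAttractors h (fp f)) ×
    (fp f ≡ 0 → ∃ λ (h : F n) → (h ∼ f) ×
    (Σ (Subset n) λ X → IsAttractor h X ×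
    (∀ Y → IsAttractor h Y → Y ≐ X) × size X ≤ 4))
theorem3 (suc n) _ f = with-fixed , without-fixed
  where
  with-fixed : 1 ≤ fp f → ∃ λ (h : F (suc n)) → (h ∼ f) × NumAttractors h (fp f)
  with-fixed 1≤ =
    let x , fx = fixed-point-exists f 1≤
    in fixed-case f x fx (double (top n)) (cong double (pow≡1+top n)) (odd-double (top n))
  without-fixed : fp f ≡ 0 → Goal f
  without-fixed e with Arrange.any-conf? f (λ x → f (f x) ≟C x)
  ... | yes t = two-cycles n (no-fixed-point f e) t
  ... | no no2 = no-short-cycles f (no-fixed-point f e) (λ x e' → no2 (x , e'))
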